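{- Let $q=3^d$ with $d$ even, and consider an elliptic curve $E\colon y^2=x^3+a_4x+b$ over $\mathbb{F}_q$ (with $a_4, b\in\mathbb{F}_q$) such that $-a_4=\gamma^2$ for some $\gamma\in\mathbb{F}_q^\times$ which is not a square in $\mathbb{F}_q^\times$. Then \[\#E(\mathbb{F}_q)=\begin{cases} q+1+(-1)^{\frac d2}\,2\sqrt q & \text{if } \operatorname{Tr}(b\gamma^{ -3})=0,\\ q+1-(-1)^{\frac d2}\sqrt q & \text{if } \operatorname{Tr}(b\gamma^{ -3})=\pm1. \end{cases}\]
   Context: $\operatorname{Tr}$ denotes the trace map $\mathbb{F}_q\to\mathbb{F}_3$, with $\mathbb{F}_3=\{0,1,-1\}$. $\#E(\mathbb{F}_q)$ counts all $\mathbb{F}_q$-rational points, including the point at infinity. -}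

module Defs where

open import Level using (Level; _⊔_)
open import Algebra.Bundles using (CommutativeRing; Semiring)
open import Algebra.Apartness.Bundles using (HeytingField; HeytingCommutativeRing)
open import Data.Fin.Base using (Fin; toℕ)
import Data.Maybe.Relation.Binary.Pointwise as Maybe
open import Data.Nat.Base as ℕ using (ℕ)
open import Data.Product.Base using (_×_; ∃-syntax; Σ-syntax; _,_; proj₁)
open import Data.Product.Relation.Binary.Pointwise.NonDependent using (×-setoid)
open import Function.Bundles using (Inverse)
open import Relation.Binary.Bundles using (Setoid)
import Relation.Binary.Construct.On as On
import Relation.Binary.PropositionalEquality.Properties as ≡

private
  variable
    a ℓ : Level

HasCardinality : Setoid a ℓ → ℕ → Set (a ⊔ ℓ)
HasCardinality S n = Inverse S (≡.setoid (Fin n))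

-- In a Heyting field `x # 0#` means exactly that x is invertible.  When the
-- field has finite cardinality, `_≈_` is decidable and `x # y` is equivalent
-- to `¬ (x ≈ y)`, so a Heyting field of cardinality q is a field 𝔽_q in the
-- ordinary sense.
module OverField {c ℓ₁ ℓ₂} (K : HeytingField c ℓ₁ ℓ₂) where

  open HeytingField K
  open HeytingCommutativeRing heytingCommutativeRing using (commutativeRing)
  open Semiring (CommutativeRing.semiring commutativeRing) using (rawSemiring)

  open import Algebra.Definitions.RawSemiring rawSemiring public
    using (_^_; sum)
  open import Algebra.Definitions.RawSemiring rawSemiring
    using () renaming (_×_ to _·_)

  -- The library gives an inverse of `x - 0#`, which is `≈ x`.
  inverse : ∀ {x} → x # 0# → Carrier
  inverse x#0 = proj₁ (#⇒invertible x#0)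

  IsUnitSquare : Carrier → Set (c ⊔ ℓ₁ ⊔ ℓ₂)
  IsUnitSquare x = ∃[ y ] (y # 0# × x ≈ y ^ 2)

  -- The trace 𝔽_{3^d} → 𝔽₃ as the sum of the Galois conjugates
  -- x + x³ + x⁹ + ⋯ + x^(3^(d-1)).  Its value is taken in K, where 𝔽₃ is
  -- the prime subfield {0#, 1#, - 1#}.
  Tr : ℕ → Carrier → Carrier
  Tr d x = sum {d} λ i → x ^ (3 ℕ.^ toℕ i)

  -- y² = x³ + a₄x + b, with discriminant -16(4a₄³ + 27b²).
  record EllipticCurve : Set (c ⊔ ℓ₂) where
    field
      a₄ b : Carrier

    Δ : Carrier
    Δ = - (16 · (4 · (a₄ ^ 3) + 27 · (b ^ 2)))

    field
      nonsingular : Δ # 0#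

  module _ (E : EllipticCurve) where
    open EllipticCurve E

    AffinePoint : Set (c ⊔ ℓ₁)
    AffinePoint = Σ[ (x , y) ∈ Carrier × Carrier ] y ^ 2 ≈ x ^ 3 + a₄ * x + b

    -- Affine points are compared by their coordinates only.
    affinePoints : Setoid (c ⊔ ℓ₁) ℓ₁
    affinePoints = On.setoid {B = AffinePoint} (×-setoid setoid setoid) proj₁

    -- `nothing` is the point at infinity.
    points : Setoid (c ⊔ ℓ₁) (c ⊔ ℓ₁)
    points = Maybe.setoid affinePoints

-- Substituting γ x for x turns E into γ³ (L x + c) = y² with L x = x³ - x and
-- c = b γ⁻³. As γ is not a square, #E = q + 1 - S c, where
-- S c = ∑ₓ χ (L x + c) and χ is the quadratic character. The image of L is
-- the kernel of the trace and its fibres have three elements, so S c = 3 A (Tr c)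
-- with A t the sum of χ over the trace class t. Here A 0 + A 1 + A (- 1) = ∑ χ = 0
-- and A (- 1) = A 1, while counting points on conics gives ∑ S² = 2 q². Hence S c = σ
-- when Tr c = ± 1 and S c = - 2 σ when Tr c = 0, for a σ with σ² = q. The sign of σ
-- is found modulo 4: S 0 = ∑ᵤ χ u · #{t : t² = u² + 1}, and pairing u with - u
-- yields S 0 ≡ - 2 modulo 8, so σ ≡ 1 ≡ (- 3) ^ (d / 2) modulo 4.

{-# OPTIONS --safe #-}
module Submission where

open import Defs
open import Algebra.Apartness.Bundles using (HeytingField; HeytingCommutativeRing)
import Algebra.Apartness.Properties.HeytingCommutativeRing as HeytingProperties
open import Algebra.Bundles using (AbelianGroup; CommutativeMonoid; CommutativeRing; RawRing; Semiring)
import Algebra.Properties.CommutativeMonoid.Sum as CommutativeMonoidSum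
import Algebra.Properties.Group as GroupProperties
import Algebra.Properties.Semiring.Sum as SemiringSum
import Algebra.Solver.Ring as RingSolver
open import Algebra.Solver.Ring.AlmostCommutativeRing using (fromCommutativeRing; _-Raw-AlmostCommutative⟶_)
open import Data.Fin.Base using (Fin; zero; suc; toℕ; inject≤; _↑ˡ_; _↑ʳ_; combine; remQuot)
open import Data.Fin.Permutation using (permutation)
import Data.Fin.Properties as Fin
open import Data.Integer.Base as ℤ using (ℤ; +_; 0ℤ; 1ℤ; -1ℤ)
open import Data.Integer.Divisibility.Signed
  using (divides; *-cancelˡ-∣; ∣-trans; ∣m∣n⇒∣m+n; ∣m∣n⇒∣m-n; ∣n⇒∣m*n) renaming (_∣_ to _∣ᶻ_; _∣?_ to _∣ᶻ?_)
import Data.Integer.Properties as ℤₚ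
import Data.Integer.Solver as ℤSolver
open import Data.Maybe.Base using (Maybe; just; nothing)
import Data.Maybe.Relation.Binary.Pointwise as Maybe
open import Data.Nat.Base as ℕ using (ℕ; zero; suc; _<_; z≤n; s≤s)
import Data.Nat.DivMod as ℕ
open import Data.Nat.Divisibility as ℕ using (_∣_)
import Data.Nat.Properties as ℕₚ
open import Data.Product.Base using (Σ-syntax; ∃-syntax; _×_; _,_; proj₁; proj₂)
open import Data.Product.Relation.Binary.Pointwise.NonDependent using (×-setoid)
open import Data.Sum.Base using (_⊎_; inj₁; inj₂)
open import Function.Base using (_∘_; id)
open import Function.Bundles using (Inverse)
open import Function.Definitions using (Injective)
open import Level using (0ℓ; _⊔_; Lift; lift; lower)
open import Relation.Binary.Bundles using (Setoid)
import Relation.Binary.Construct.On as On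
open import Relation.Binary.Definitions using (Decidable; tri<; tri≈; tri>)
open import Relation.Binary.PropositionalEquality as ≡ using (_≡_; _≢_; cong; cong₂)
import Relation.Binary.Reasoning.Setoid as SetoidReasoning
open import Relation.Nullary using (¬_; Dec; yes; no; contradiction)
import Relation.Nullary.Decidable as Dec
open import Relation.Nullary.Decidable using (from-no; ¬?)

open ℤSolver.+-*-Solver using ()
  renaming (solve to solveℤ; con to κ; _:+_ to _⊕_; _:*_ to _⊗_; _:-_ to _⊖_; :-_ to ⊝_; _:=_ to _⊜_)

-- Two exact counts are obtained from inequalities: that a nonsquare factor exchanges nonzero
-- squares and nonsquares (`N-twist`), and that every element of trace zero has the form `L x`
-- (`fibre-L`). In each case an upper bound holds pointwise and both sides have the same total over
-- the field, so no slack is left anywhere and no preimage has to be constructed.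
--
-- The second moment leaves the sign of `σ` open, and the parity of `d` settles it: `d` even gives
-- `8 ∣ q - 1`, which makes `- 1` a square and `χ` an even function. The nonsquare `γ` serves a
-- second time here. The sum of `N (γ u) N (1 + u²)` is `q - 1 - S₀`; its terms for `u ≠ 0` are
-- multiples of 4 that agree at `u` and `- u`, so modulo 8 only the term 2 at `u = 0` survives.
-- Passing from `χ u` to the count `N (γ u) = 1 - χ u` supplies a factor 2 that `χ u = ± 1` cannot
-- give.

-- Sums over finite index sets and finite setoids

module FinSum {b ℓ} (M : CommutativeMonoid b ℓ) where
  open CommutativeMonoid M
  open CommutativeMonoidSum M using (sum; sum-cong-≋; sum-replicate-zero)
  open import Relation.Binary.Reasoning.Setoid setoid

  sum-unique : ∀ {n} (t : Fin n → Carrier) i → (∀ j → j ≢ i → t j ≈ ε) → sum t ≈ t i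
  sum-unique {suc n} t zero    t≈ε =
    trans (∙-congˡ (trans (sum-cong-≋ λ j → t≈ε (suc j) λ ()) (sum-replicate-zero n))) (identityʳ _)
  sum-unique {suc n} t (suc i) t≈ε =
    trans (∙-cong (t≈ε zero λ ()) (sum-unique (t ∘ suc) i λ j j≢i → t≈ε (suc j) (j≢i ∘ Fin.suc-injective)))
      (identityˡ _)

  sum-↑ : ∀ m {n} (t : Fin (m ℕ.+ n) → Carrier) → sum t ≈ sum (t ∘ (_↑ˡ n)) ∙ sum (t ∘ (m ↑ʳ_))
  sum-↑ zero    t = sym (identityˡ _)
  sum-↑ (suc m) t = trans (∙-congˡ (sum-↑ m (t ∘ suc))) (sym (assoc _ _ _))

  sum-combine : ∀ m {n} (t : Fin (m ℕ.* n) → Carrier) → sum t ≈ sum {m} λ i → sum {n} λ j → t (combine i j)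
  sum-combine zero        t = refl
  sum-combine (suc m) {n} t = trans (sum-↑ n t) (∙-congˡ (sum-combine m (t ∘ (n ↑ʳ_))))

module Finite {a ℓ} (S : Setoid a ℓ) {n} (card : HasCardinality S n) where
  open Setoid S
  open Inverse card using (to; from; to-cong; from-cong; strictlyInverseˡ; strictlyInverseʳ) public

  to-injective : ∀ {x y} → to x ≡ to y → x ≈ y
  to-injective {x} {y} eq = trans (sym (strictlyInverseʳ x)) (trans (from-cong eq) (strictlyInverseʳ y))

  from-injective : Injective _≡_ _≈_ from
  from-injective {i} {j} eq = ≡.trans (≡.sym (strictlyInverseˡ i)) (≡.trans (to-cong eq) (strictlyInverseˡ j))

  infix 4 _≟_
  _≟_ : Decidable _≈_
  x ≟ y = Dec.map′ to-injective to-cong (to x Fin.≟ to y)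

  decide∃ : ∀ {p} {P : Carrier → Set p} → (∀ {x y} → x ≈ y → P x → P y) →
            (∀ x → Dec (P x)) → Dec (∃[ x ] P x)
  decide∃ resp P? = Dec.map′ (λ (i , p) → from i , p) (λ (x , p) → to x , resp (sym (strictlyInverseʳ x)) p)
                             (Fin.any? (P? ∘ from))

  module Sum {b ℓ′} (M : CommutativeMonoid b ℓ′) where
    private module M = CommutativeMonoid M
    open CommutativeMonoidSum M using (sum; sum-cong-≋; sum-permute; ∑-distrib-+; ∑-comm)

    Congruent : (Carrier → M.Carrier) → Set _
    Congruent f = ∀ {x y} → x ≈ y → f x M.≈ f y

    ∑ : (Carrier → M.Carrier) → M.Carrier
    ∑ f = sum (f ∘ from)

    ∑-cong : ∀ {f g} → (∀ x → f x M.≈ g x) → ∑ f M.≈ ∑ g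
    ∑-cong f≈g = sum-cong-≋ (f≈g ∘ from)

    ∑-∙ : ∀ f g → ∑ (λ x → f x M.∙ g x) M.≈ ∑ f M.∙ ∑ g
    ∑-∙ f g = ∑-distrib-+ (f ∘ from) (g ∘ from)

    ∑-swap : ∀ (f : Carrier → Carrier → M.Carrier) → ∑ (λ x → ∑ (f x)) M.≈ ∑ (λ y → ∑ λ x → f x y)
    ∑-swap f = ∑-comm λ i j → f (from i) (from j)

    ∑-single : ∀ {f} → Congruent f → ∀ x → (∀ y → ¬ y ≈ x → f y M.≈ M.ε) → ∑ f M.≈ f x
    ∑-single {f} f-cong x f≈ε = M.trans
      (FinSum.sum-unique M (f ∘ from) (to x) λ j j≢tox →
        f≈ε (from j) λ eq → j≢tox (≡.trans (≡.sym (strictlyInverseˡ j)) (to-cong eq)))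
      (f-cong (strictlyInverseʳ x))

    ∑-reindex : ∀ {f} → Congruent f → (σ τ : Carrier → Carrier) →
                (∀ {x y} → x ≈ y → σ x ≈ σ y) → (∀ {x y} → x ≈ y → τ x ≈ τ y) →
                (∀ x → σ (τ x) ≈ x) → (∀ x → τ (σ x) ≈ x) →
                ∑ f M.≈ ∑ (f ∘ σ)
    ∑-reindex {f} f-cong σ τ σ-cong τ-cong στ τσ = M.trans
      (sum-permute (f ∘ from) (permutation (to ∘ σ ∘ from) (to ∘ τ ∘ from)
        (λ i → ≡.trans (to-cong (trans (σ-cong (strictlyInverseʳ _)) (στ _))) (strictlyInverseˡ i))
        (λ i → ≡.trans (to-cong (trans (τ-cong (strictlyInverseʳ _)) (τσ _))) (strictlyInverseˡ i))))
      (sum-cong-≋ {n} λ i → f-cong (strictlyInverseʳ (σ (from i))))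

-- Integer sums, indicators and enumeration of decidable subsets

module ℤSum where
  private module ℤ-+ = GroupProperties (AbelianGroup.group ℤₚ.+-0-abelianGroup)
  open CommutativeMonoidSum ℤₚ.+-0-commutativeMonoid using (sum) public

  sum-mono-≤ : ∀ {n} {f g : Fin n → ℤ} → (∀ i → f i ℤ.≤ g i) → sum f ℤ.≤ sum g
  sum-mono-≤ {zero}  f≤g = ℤₚ.≤-refl
  sum-mono-≤ {suc n} f≤g = ℤₚ.+-mono-≤ (f≤g zero) (sum-mono-≤ (f≤g ∘ suc))

  +-mono-≤-rigid : ∀ {a b c d} → a ℤ.≤ b → c ℤ.≤ d → a ℤ.+ c ≡ b ℤ.+ d → a ≡ b × c ≡ d
  +-mono-≤-rigid {a} {b} {c} {d} a≤b c≤d eq = a≡b , ℤ-+.∙-cancelˡ a c d (≡.trans eq (cong (ℤ._+ d) (≡.sym a≡b)))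
    where
    open ℤₚ.≤-Reasoning
    add-sub : ∀ b d → b ≡ (b ℤ.+ d) ℤ.- d
    add-sub = solveℤ 2 (λ b d → b ⊜ (b ⊕ d) ⊖ d) ≡.refl
    a≡b : a ≡ b
    a≡b = ℤₚ.≤-antisym a≤b (begin
      b                 ≡⟨ add-sub b d ⟩
      (b ℤ.+ d) ℤ.- d   ≡⟨ cong (ℤ._- d) eq ⟨
      (a ℤ.+ c) ℤ.- d   ≤⟨ ℤₚ.+-monoʳ-≤ (a ℤ.+ c) (ℤₚ.neg-mono-≤ c≤d) ⟩
      (a ℤ.+ c) ℤ.- c   ≡⟨ add-sub a c ⟨
      a                 ∎)

  -- Termwise bounds with equal totals leave no slack in any term. This turns one-sided counting
  -- bounds into exact fibre sizes.
  sum-mono-≤-rigid : ∀ {n} {f g : Fin n → ℤ} → (∀ i → f i ℤ.≤ g i) → sum f ≡ sum g → ∀ i → f i ≡ g i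
  sum-mono-≤-rigid f≤g eq zero    = proj₁ (+-mono-≤-rigid (f≤g zero) (sum-mono-≤ (f≤g ∘ suc)) eq)
  sum-mono-≤-rigid f≤g eq (suc i) =
    sum-mono-≤-rigid (f≤g ∘ suc) (proj₂ (+-mono-≤-rigid (f≤g zero) (sum-mono-≤ (f≤g ∘ suc)) eq)) i

-- The Iverson bracket, with integer values so that counts can be subtracted and multiplied.
⟦_⟧ : ∀ {p} {P : Set p} → Dec P → ℤ
⟦ yes _ ⟧ = 1ℤ
⟦ no  _ ⟧ = 0ℤ

⟦⟧-yes : ∀ {p} {P : Set p} (P? : Dec P) → P → ⟦ P? ⟧ ≡ 1ℤ
⟦⟧-yes (yes _) _ = ≡.refl
⟦⟧-yes (no ¬p) p = contradiction p ¬p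

⟦⟧-no : ∀ {p} {P : Set p} (P? : Dec P) → ¬ P → ⟦ P? ⟧ ≡ 0ℤ
⟦⟧-no (yes p) ¬p = contradiction p ¬p
⟦⟧-no (no _)  _  = ≡.refl

⟦⟧-cong : ∀ {p r} {P : Set p} {R : Set r} (P? : Dec P) (R? : Dec R) → (P → R) → (R → P) → ⟦ P? ⟧ ≡ ⟦ R? ⟧
⟦⟧-cong P? (yes r) P⇒R R⇒P = ⟦⟧-yes P? (R⇒P r)
⟦⟧-cong P? (no ¬r) P⇒R R⇒P = ⟦⟧-no P? (¬r ∘ P⇒R)

-- `index` takes a proof of `P i`, and such proofs need not be unique. `element-injective` together
-- with `element-index` makes the index independent of the proof, as required when points are
-- compared by coordinates only.
record SubsetEnumeration {n p} (P : Fin n → Set p) (k : ℕ) : Set p where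
  field
    element           : Fin k → Fin n
    element-injective : Injective _≡_ _≡_ element
    element-∈         : ∀ j → P (element j)
    index             : ∀ i → P i → Fin k
    element-index     : ∀ i p → element (index i p) ≡ i

enumerate : ∀ {n p} {P : Fin n → Set p} (P? : ∀ i → Dec (P i)) →
            ∃[ k ] SubsetEnumeration P k × + k ≡ ℤSum.sum (λ i → ⟦ P? i ⟧)
enumerate {zero} P? = 0 , record
  { element = λ () ; element-injective = λ { {()} } ; element-∈ = λ () ; index = λ ()
  ; element-index = λ () } , ≡.refl
enumerate {suc n} {P = P} P? with P? zero | enumerate (P? ∘ suc)
... | yes p | k , e , eq = suc k , record
  { element = λ { zero → zero ; (suc j) → suc (E.element j) }
  ; element-injective = λ
    { {zero} {zero} _ → ≡.refl
    ; {zero} {suc _} ()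
    ; {suc _} {zero} ()
    ; {suc _} {suc _} eq → cong suc (E.element-injective (Fin.suc-injective eq)) }
  ; element-∈ = λ { zero → p ; (suc j) → E.element-∈ j }
  ; index = λ { zero _ → zero ; (suc i) p → suc (E.index i p) }
  ; element-index = λ { zero _ → ≡.refl ; (suc i) p → cong suc (E.element-index i p) }
  } , cong ℤ.suc eq
  where module E = SubsetEnumeration e
... | no ¬p | k , e , eq = k , record
  { element = suc ∘ E.element
  ; element-injective = E.element-injective ∘ Fin.suc-injective
  ; element-∈ = E.element-∈
  ; index = λ { zero p → contradiction p ¬p ; (suc i) p → E.index i p }
  ; element-index = λ { zero p → contradiction p ¬p ; (suc i) p → cong suc (E.element-index i p) }
  } , ≡.trans eq (≡.sym (ℤₚ.+-identityˡ _))
  where module E = SubsetEnumeration e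

-- Commutative rings of characteristic 3

data 𝔽₃ : Set where
  0₃ 1₃ -1₃ : 𝔽₃

-- The coefficient ring of the ring solver. Normal forms are thereby reduced modulo 3, so identities
-- special to characteristic 3, such as additivity of cubing, hold by normalisation.
𝔽₃-rawRing : RawRing 0ℓ 0ℓ
𝔽₃-rawRing = record { _≈_ = _≡_ ; _+_ = _+_ ; _*_ = _*_ ; -_ = -_ ; 0# = 0₃ ; 1# = 1₃ }
  where
  infixl 6 _+_
  infixl 7 _*_
  _+_ _*_ : 𝔽₃ → 𝔽₃ → 𝔽₃
  0₃  + y   = y
  x   + 0₃  = x
  1₃  + 1₃  = -1₃
  1₃  + -1₃ = 0₃
  -1₃ + 1₃  = 0₃
  -1₃ + -1₃ = 1₃
  0₃  * y   = 0₃
  x   * 0₃  = 0₃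
  1₃  * y   = y
  x   * 1₃  = x
  -1₃ * -1₃ = 1₃
  -_ : 𝔽₃ → 𝔽₃
  - 0₃  = 0₃
  - 1₃  = -1₃
  - -1₃ = 1₃

HasCharacteristic3 : ∀ {c ℓ} → CommutativeRing c ℓ → Set ℓ
HasCharacteristic3 R = 1# + 1# + 1# ≈ 0#
  where open CommutativeRing R

module Characteristic3 {c ℓ} (R : CommutativeRing c ℓ) (3≈0 : HasCharacteristic3 R) where
  open CommutativeRing R hiding (zero)
  open import Algebra.Definitions.RawSemiring (Semiring.rawSemiring semiring) using (_^_; sum)
  open import Algebra.Properties.Ring ring using (-0#≈0#; -‿involutive; -1*x≈-x)
  open import Algebra.Properties.AbelianGroup +-abelianGroup using (⁻¹-∙-comm)
  open import Algebra.Properties.Semiring.Exp semiring using (^-congˡ; ^-congʳ; ^-assocʳ)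
  open import Algebra.Properties.CommutativeMonoid.Sum +-commutativeMonoid using (sum-cong-≋; sum-init-last)
  open import Relation.Binary.Reasoning.Setoid setoid

  private
    module F = RawRing 𝔽₃-rawRing

    value : 𝔽₃ → Carrier
    value 0₃  = 0#
    value 1₃  = 1#
    value -1₃ = - 1#

    1+1≈-1 : 1# + 1# ≈ - 1#
    1+1≈-1 = begin
      1# + 1#                ≈⟨ +-identityʳ _ ⟨
      1# + 1# + 0#           ≈⟨ +-congˡ (-‿inverseʳ 1#) ⟨
      1# + 1# + (1# - 1#)    ≈⟨ +-assoc _ _ _ ⟨
      1# + 1# + 1# - 1#      ≈⟨ +-congʳ 3≈0 ⟩
      0# - 1#                ≈⟨ +-identityˡ _ ⟩
      - 1#                   ∎

    +-homo : ∀ x y → value (x F.+ y) ≈ value x + value y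
    +-homo 0₃  y   = sym (+-identityˡ _)
    +-homo 1₃  0₃  = sym (+-identityʳ _)
    +-homo -1₃ 0₃  = sym (+-identityʳ _)
    +-homo 1₃  1₃  = sym 1+1≈-1
    +-homo 1₃  -1₃ = sym (-‿inverseʳ 1#)
    +-homo -1₃ 1₃  = sym (-‿inverseˡ 1#)
    +-homo -1₃ -1₃ = sym (trans (⁻¹-∙-comm 1# 1#) (trans (-‿cong 1+1≈-1) (-‿involutive 1#)))

    -‿homo : ∀ x → value (F.- x) ≈ - value x
    -‿homo 0₃  = sym -0#≈0#
    -‿homo 1₃  = refl
    -‿homo -1₃ = sym (-‿involutive 1#)

    *-homo : ∀ x y → value (x F.* y) ≈ value x * value y
    *-homo 0₃  y   = sym (zeroˡ _)
    *-homo 1₃  0₃  = sym (zeroʳ _)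
    *-homo -1₃ 0₃  = sym (zeroʳ _)
    *-homo 1₃  1₃  = sym (*-identityˡ _)
    *-homo 1₃  -1₃ = sym (*-identityˡ _)
    *-homo -1₃ 1₃  = sym (*-identityʳ _)
    *-homo -1₃ -1₃ = sym (trans (-1*x≈-x _) (-‿involutive _))

    morphism : 𝔽₃-rawRing -Raw-AlmostCommutative⟶ fromCommutativeRing R
    morphism = record
      { ⟦_⟧ = value ; +-homo = +-homo ; *-homo = *-homo ; -‿homo = -‿homo ; 0-homo = refl ; 1-homo = refl }

    _coeff≟_ : ∀ x y → Maybe (value x ≈ value y)
    0₃  coeff≟ 0₃  = just refl
    1₃  coeff≟ 1₃  = just refl
    -1₃ coeff≟ -1₃ = just refl
    _   coeff≟ _   = nothing

  open RingSolver 𝔽₃-rawRing (fromCommutativeRing R) morphism _coeff≟_ public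
    using (solve; con; _:=_; _:+_; _:*_; _:-_; :-_; _:^_)

  x-y≈0⇒x≈y : ∀ {x y} → x - y ≈ 0# → x ≈ y
  x-y≈0⇒x≈y {x} {y} eq = trans (solve 2 (λ x y → x := x :- y :+ y) refl x y) (trans (+-congʳ eq) (+-identityˡ y))

  cube-+ : ∀ x y → (x + y) ^ 3 ≈ x ^ 3 + y ^ 3
  cube-+ = solve 2 (λ x y → (x :+ y) :^ 3 := x :^ 3 :+ y :^ 3) refl

  ^3^-+ : ∀ k x y → (x + y) ^ (3 ℕ.^ k) ≈ x ^ (3 ℕ.^ k) + y ^ (3 ℕ.^ k)
  ^3^-+ zero    x y = trans (*-identityʳ _) (sym (+-cong (*-identityʳ _) (*-identityʳ _)))
  ^3^-+ (suc k) x y = begin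
    (x + y) ^ (3 ℕ.* 3 ℕ.^ k)                        ≈⟨ ^-assocʳ (x + y) 3 (3 ℕ.^ k) ⟨
    ((x + y) ^ 3) ^ (3 ℕ.^ k)                        ≈⟨ ^-congˡ (3 ℕ.^ k) (cube-+ x y) ⟩
    (x ^ 3 + y ^ 3) ^ (3 ℕ.^ k)                      ≈⟨ ^3^-+ k (x ^ 3) (y ^ 3) ⟩
    (x ^ 3) ^ (3 ℕ.^ k) + (y ^ 3) ^ (3 ℕ.^ k)        ≈⟨ +-cong (^-assocʳ x 3 (3 ℕ.^ k)) (^-assocʳ y 3 (3 ℕ.^ k)) ⟩
    x ^ (3 ℕ.* 3 ℕ.^ k) + y ^ (3 ℕ.* 3 ℕ.^ k)        ∎

  -- The trace as an additive map and as a polynomial function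

  trace : ℕ → Carrier → Carrier
  trace d x = sum {d} λ i → x ^ (3 ℕ.^ toℕ i)

  -- Splitting off the first conjugate and moving Frobenius into the argument gives a recursion in
  -- which the inductions on `d` apply their hypothesis to cubes.
  trace-suc : ∀ d x → trace (suc d) x ≈ x + trace d (x ^ 3)
  trace-suc d x = +-cong (*-identityʳ x) (sum-cong-≋ {d} λ i → sym (^-assocʳ x 3 (3 ℕ.^ toℕ i)))

  trace-cong : ∀ d {x y} → x ≈ y → trace d x ≈ trace d y
  trace-cong d x≈y = sum-cong-≋ λ (i : Fin d) → ^-congˡ (3 ℕ.^ toℕ i) x≈y

  trace-+ : ∀ d x y → trace d (x + y) ≈ trace d x + trace d y
  trace-+ zero    x y = sym (+-identityˡ 0#)
  trace-+ (suc d) x y = begin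
    trace (suc d) (x + y)                              ≈⟨ trace-suc d (x + y) ⟩
    x + y + trace d ((x + y) ^ 3)                      ≈⟨ +-congˡ (trace-cong d (cube-+ x y)) ⟩
    x + y + trace d (x ^ 3 + y ^ 3)                    ≈⟨ +-congˡ (trace-+ d (x ^ 3) (y ^ 3)) ⟩
    x + y + (trace d (x ^ 3) + trace d (y ^ 3))
      ≈⟨ solve 4 (λ x y s t → x :+ y :+ (s :+ t) := x :+ s :+ (y :+ t)) refl x y _ _ ⟩
    x + trace d (x ^ 3) + (y + trace d (y ^ 3))        ≈⟨ +-cong (trace-suc d x) (trace-suc d y) ⟨
    trace (suc d) x + trace (suc d) y                  ∎

  trace-0 : ∀ d → trace d 0# ≈ 0#
  trace-0 d = begin
    trace d 0#                                ≈⟨ solve 1 (λ t → t := t :+ t :- t) refl (trace d 0#) ⟩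
    trace d 0# + trace d 0# - trace d 0#      ≈⟨ +-congʳ (trace-+ d 0# 0#) ⟨
    trace d (0# + 0#) - trace d 0#            ≈⟨ +-congʳ (trace-cong d (+-identityˡ 0#)) ⟩
    trace d 0# - trace d 0#                   ≈⟨ -‿inverseʳ _ ⟩
    0#                                        ∎

  trace-neg : ∀ d x → trace d (- x) ≈ - trace d x
  trace-neg d x = begin
    trace d (- x)                             ≈⟨ solve 2 (λ s t → s := s :+ t :- t) refl (trace d (- x)) (trace d x) ⟩
    trace d (- x) + trace d x - trace d x     ≈⟨ +-congʳ (trace-+ d (- x) x) ⟨
    trace d (- x + x) - trace d x             ≈⟨ +-congʳ (trans (trace-cong d (-‿inverseˡ x)) (trace-0 d)) ⟩
    0# - trace d x                            ≈⟨ +-identityˡ _ ⟩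
    - trace d x                               ∎

  trace-cube : ∀ d x → trace d (x ^ 3) ≈ trace d x ^ 3
  trace-cube zero    x = solve 0 (con 0₃ := con 0₃ :^ 3) refl
  trace-cube (suc d) x = begin
    trace (suc d) (x ^ 3)                     ≈⟨ trace-suc d (x ^ 3) ⟩
    x ^ 3 + trace d ((x ^ 3) ^ 3)             ≈⟨ +-congˡ (trace-cube d (x ^ 3)) ⟩
    x ^ 3 + trace d (x ^ 3) ^ 3               ≈⟨ cube-+ x (trace d (x ^ 3)) ⟨
    (x + trace d (x ^ 3)) ^ 3                 ≈⟨ ^-congˡ 3 (trace-suc d x) ⟨
    trace (suc d) x ^ 3                       ∎

  -- The conjugates of `x ^ 3` are those of `x` shifted by one place, so the two traces differ only
  -- in their end terms. Once `x ^ q ≈ x` is known, the end terms cancel.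
  trace-telescope : ∀ d x → x + trace d (x ^ 3) ≈ trace d x + x ^ (3 ℕ.^ d)
  trace-telescope zero    x = solve 1 (λ x → x :+ con 0₃ := con 0₃ :+ x :^ 1) refl x
  trace-telescope (suc d) x = begin
    x + trace (suc d) (x ^ 3)                                ≈⟨ +-congˡ (trace-suc d (x ^ 3)) ⟩
    x + (x ^ 3 + trace d ((x ^ 3) ^ 3))                      ≈⟨ +-congˡ (trace-telescope d (x ^ 3)) ⟩
    x + (trace d (x ^ 3) + (x ^ 3) ^ (3 ℕ.^ d))              ≈⟨ +-assoc _ _ _ ⟨
    x + trace d (x ^ 3) + (x ^ 3) ^ (3 ℕ.^ d)
      ≈⟨ +-cong (sym (trace-suc d x)) (^-assocʳ x 3 (3 ℕ.^ d)) ⟩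
    trace (suc d) x + x ^ (3 ℕ.^ suc d)                      ∎

  -- f is a polynomial function of degree at most n in which x ^ n has the
  -- coefficient a. No coefficient list is needed: the condition asks that
  -- every difference quotient (f x - f r) / (x - r) extends to such a
  -- function of degree at most n - 1.
  Polynomial : ℕ → Carrier → (Carrier → Carrier) → Set (c ⊔ ℓ)
  Polynomial zero    a f = Lift c (∀ x → f x ≈ a)
  Polynomial (suc n) a f = ∀ r → ∃[ g ] Polynomial n a g × (∀ x → f x ≈ f r + (x - r) * g x)

  Polynomial-cong : ∀ n {a b f g} → a ≈ b → (∀ x → f x ≈ g x) → Polynomial n a f → Polynomial n b g
  Polynomial-cong zero    a≈b f≈g p = lift λ x → trans (sym (f≈g x)) (trans (lower p x) a≈b)
  Polynomial-cong (suc n) a≈b f≈g p r with h , ph , eq ← p r =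
    h , Polynomial-cong n a≈b (λ _ → refl) ph , λ x → trans (sym (f≈g x)) (trans (eq x) (+-congʳ (f≈g r)))

  Polynomial-+ : ∀ n {a b f g} → Polynomial n a f → Polynomial n b g → Polynomial n (a + b) (λ x → f x + g x)
  Polynomial-+ zero    p q = lift λ x → +-cong (lower p x) (lower q x)
  Polynomial-+ (suc n) {f = f} {g} p q r with f′ , pf′ , eqf ← p r | g′ , pg′ , eqg ← q r =
    (λ x → f′ x + g′ x) , Polynomial-+ n pf′ pg′ , λ x → trans (+-cong (eqf x) (eqg x))
      (solve 5 (λ fr gr d f′ g′ → fr :+ d :* f′ :+ (gr :+ d :* g′) := fr :+ gr :+ d :* (f′ :+ g′)) refl
        (f r) (g r) (x - r) (f′ x) (g′ x))

  Polynomial-scale : ∀ n k {a f} → Polynomial n a f → Polynomial n (k * a) (λ x → k * f x)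
  Polynomial-scale zero    k p = lift λ x → *-congˡ (lower p x)
  Polynomial-scale (suc n) k {f = f} p r with g , pg , eq ← p r =
    (λ x → k * g x) , Polynomial-scale n k pg , λ x → trans (*-congˡ (eq x))
      (solve 4 (λ k fr d g → k :* (fr :+ d :* g) := k :* fr :+ d :* (k :* g)) refl k (f r) (x - r) (g x))

  Polynomial-suc : ∀ n {a f} → Polynomial n a f → Polynomial (suc n) 0# f
  Polynomial-suc zero    {f = f} p r = (λ _ → 0#) , lift (λ _ → refl) , λ x →
    trans (lower p x) (trans (sym (lower p r)) (solve 2 (λ fr d → fr := fr :+ d :* con 0₃) refl (f r) (x - r)))
  Polynomial-suc (suc n) p r with g , pg , eq ← p r = g , Polynomial-suc n pg , eq

  Polynomial-< : ∀ {m n a f} → m < n → Polynomial m a f → Polynomial n 0# f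
  Polynomial-< {m} {suc n} (s≤s m≤n) p with ℕₚ.m≤n⇒m<n∨m≡n m≤n
  ... | inj₁ m<n    = Polynomial-suc n (Polynomial-< m<n p)
  ... | inj₂ ≡.refl = Polynomial-suc n p

  -- With `g` the difference quotient of `f` at `r`, that of `x * f x` is `f x + r * g x`. Its
  -- second summand has smaller degree, so the leading coefficient stays that of `f`.
  Polynomial-x* : ∀ n {a f} → Polynomial n a f → Polynomial (suc n) a (λ x → x * f x)
  Polynomial-x* zero    {f = f} p r = f , p , λ x → begin
    x * f x                     ≈⟨ solve 3 (λ x r f → x :* f := r :* f :+ (x :- r) :* f) refl x r (f x) ⟩
    r * f x + (x - r) * f x     ≈⟨ +-congʳ (*-congˡ (trans (lower p x) (sym (lower p r)))) ⟩
    r * f r + (x - r) * f x     ∎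
  Polynomial-x* (suc n) {f = f} p r with g , pg , eq ← p r =
    (λ x → f x + r * g x) ,
    Polynomial-cong (suc n) (+-identityʳ _) (λ _ → refl)
      (Polynomial-+ (suc n) p (Polynomial-suc n (Polynomial-scale n r pg))) ,
    λ x → begin
      x * f x
        ≈⟨ solve 3 (λ x r f → x :* f := r :* f :+ (x :- r) :* f) refl x r (f x) ⟩
      r * f x + (x - r) * f x                        ≈⟨ +-congʳ (*-congˡ (eq x)) ⟩
      r * (f r + (x - r) * g x) + (x - r) * f x
        ≈⟨ solve 5 (λ x r fr f g → r :* (fr :+ (x :- r) :* g) :+ (x :- r) :* f
                            := r :* fr :+ (x :- r) :* (f :+ r :* g)) refl
             x r (f r) (f x) (g x) ⟩
      r * f r + (x - r) * (f x + r * g x)            ∎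

  Polynomial-^ : ∀ n → Polynomial n 1# (_^ n)
  Polynomial-^ zero    = lift λ _ → refl
  Polynomial-^ (suc n) = Polynomial-x* n (Polynomial-^ n)

  trace-init : ∀ k x → trace (suc k) x ≈ trace k x + x ^ (3 ℕ.^ k)
  trace-init k x = trans (sum-init-last {k} λ i → x ^ (3 ℕ.^ toℕ i))
    (+-cong (sum-cong-≋ {k} λ i → ^-congʳ x (cong (3 ℕ.^_) (Fin.toℕ-inject₁ i)))
      (^-congʳ x (cong (3 ℕ.^_) (Fin.toℕ-fromℕ k))))

  mutual
    Polynomial-trace-< : ∀ k → Polynomial (3 ℕ.^ k) 0# (trace k)
    Polynomial-trace-< zero    = Polynomial-suc 0 {0#} (lift λ _ → refl)
    Polynomial-trace-< (suc k) = Polynomial-< (ℕₚ.^-monoʳ-< 3 (s≤s (s≤s z≤n)) (ℕₚ.n<1+n k)) (Polynomial-trace k)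

    -- The last conjugate `x ^ (3 ^ k)` dominates: the earlier ones form a function of smaller
    -- degree, which contributes 0 to the leading coefficient.
    Polynomial-trace : ∀ k → Polynomial (3 ℕ.^ k) 1# (trace (suc k))
    Polynomial-trace k = Polynomial-cong (3 ℕ.^ k) (+-identityˡ 1#) (λ x → sym (trace-init k x))
      (Polynomial-+ (3 ℕ.^ k) (Polynomial-trace-< k) (Polynomial-^ (3 ℕ.^ k)))

  module _ (x*y≈0⇒x≈0∨y≈0 : ∀ {x y} → x * y ≈ 0# → x ≈ 0# ⊎ y ≈ 0#) where

    -- Splitting off the root `r zero` leaves a difference quotient of degree one less, and without
    -- zero divisors the other roots are roots of it. Thus a function of degree `n` with `n + 1`
    -- distinct roots has leading coefficient 0.
    Polynomial-roots : ∀ n {a f} → Polynomial n a f → (r : Fin (suc n) → Carrier) → Injective _≡_ _≈_ r →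
                       (∀ i → f (r i) ≈ 0#) → a ≈ 0#
    Polynomial-roots zero    p r r-inj root = trans (sym (lower p (r zero))) (root zero)
    Polynomial-roots (suc n) {f = f} p r r-inj root with g , pg , eq ← p (r zero) =
      Polynomial-roots n pg (r ∘ suc) (Fin.suc-injective ∘ r-inj) g-root
      where
      g-root : ∀ i → g (r (suc i)) ≈ 0#
      g-root i with x*y≈0⇒x≈0∨y≈0 (begin
          (r (suc i) - r zero) * g (r (suc i))               ≈⟨ +-identityˡ _ ⟨
          0# + (r (suc i) - r zero) * g (r (suc i))          ≈⟨ +-congʳ (root zero) ⟨
          f (r zero) + (r (suc i) - r zero) * g (r (suc i))  ≈⟨ eq (r (suc i)) ⟨
          f (r (suc i))                                      ≈⟨ root (suc i) ⟩
          0#                                                 ∎)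
      ... | inj₁ eq′ = contradiction (r-inj (x-y≈0⇒x≈y eq′)) λ ()
      ... | inj₂ eq′ = eq′

-- Finite fields: inverses, characteristic and Fermat's theorem

module FiniteField {c ℓ₁ ℓ₂} (K : HeytingField c ℓ₁ ℓ₂) {q} (card : HasCardinality (HeytingField.setoid K) q) where
  open HeytingField K using (_#_; #⇒invertible; invertible⇒#; #-irrefl; tight; heytingCommutativeRing)
  open HeytingCommutativeRing heytingCommutativeRing using (commutativeRing)
  open CommutativeRing commutativeRing hiding (zero)
  open HeytingProperties heytingCommutativeRing using (1#0; x-0≈x)
  open import Algebra.Properties.Ring ring using (+-cancelˡ)
  open import Algebra.Definitions.RawSemiring (Semiring.rawSemiring semiring) using (_^_) renaming (_×_ to _·_)
  open import Algebra.Properties.Semiring.Mult semiring using (×1-homo-*)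
  open import Relation.Binary.Reasoning.Setoid setoid
  open Finite setoid card using (from; _≟_; decide∃; module Sum) public

  x*y≈1⇒x*yz≈z : ∀ {x y} → x * y ≈ 1# → ∀ z → x * (y * z) ≈ z
  x*y≈1⇒x*yz≈z xy≈1 z = trans (sym (*-assoc _ _ z)) (trans (*-congʳ xy≈1) (*-identityˡ z))

  1≉0 : ¬ 1# ≈ 0#
  1≉0 1≈0 = #-irrefl 1≈0 1#0

  #0⇒≉0 : ∀ {x} → x # 0# → ¬ x ≈ 0#
  #0⇒≉0 x#0 x≈0 = #-irrefl x≈0 x#0

  #0⇒inverse : ∀ {x} (x#0 : x # 0#) → x * proj₁ (#⇒invertible x#0) ≈ 1#
  #0⇒inverse x#0 = trans (*-congʳ (sym (x-0≈x _))) (proj₂ (proj₂ (#⇒invertible x#0)))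

  inverse⇒#0 : ∀ {x y} → x * y ≈ 1# → x # 0#
  inverse⇒#0 xy≈1 = invertible⇒# (_ , trans (*-comm _ _) xy′≈1 , xy′≈1)
    where xy′≈1 = trans (*-congʳ (x-0≈x _)) xy≈1

  -- An inverse can be sought among finitely many elements. If the search fails, `x` is not apart
  -- from `0#`, and tightness of apartness gives `x ≈ 0#`.
  ≉0⇒inverse : ∀ {x} → ¬ x ≈ 0# → ∃[ y ] x * y ≈ 1#
  ≉0⇒inverse {x} x≉0 with decide∃ (λ y≈z xy≈1 → trans (*-congˡ (sym y≈z)) xy≈1) (λ y → x * y ≟ 1#)
  ... | yes inv = inv
  ... | no ¬inv = contradiction (proj₁ (tight x 0#) λ x#0 → ¬inv (_ , #0⇒inverse x#0)) x≉0

  *-cancelˡ-≉0 : ∀ {x y z} → ¬ x ≈ 0# → x * y ≈ x * z → y ≈ z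
  *-cancelˡ-≉0 {x} {y} {z} x≉0 eq with x⁻¹ , xx⁻¹≈1 ← ≉0⇒inverse x≉0 = begin
    y              ≈⟨ *-identityˡ y ⟨
    1# * y         ≈⟨ *-congʳ (trans (*-comm x⁻¹ x) xx⁻¹≈1) ⟨
    x⁻¹ * x * y    ≈⟨ *-assoc _ _ _ ⟩
    x⁻¹ * (x * y)  ≈⟨ *-congˡ eq ⟩
    x⁻¹ * (x * z)  ≈⟨ *-assoc _ _ _ ⟨
    x⁻¹ * x * z    ≈⟨ *-congʳ (trans (*-comm x⁻¹ x) xx⁻¹≈1) ⟩
    1# * z         ≈⟨ *-identityˡ z ⟩
    z              ∎

  x*y≈0⇒x≈0∨y≈0 : ∀ {x y} → x * y ≈ 0# → x ≈ 0# ⊎ y ≈ 0#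
  x*y≈0⇒x≈0∨y≈0 {x} {y} xy≈0 with x ≟ 0#
  ... | yes x≈0 = inj₁ x≈0
  ... | no  x≉0 = inj₂ (*-cancelˡ-≉0 x≉0 (trans xy≈0 (sym (zeroʳ x))))

  *-≉0 : ∀ {x y} → ¬ x ≈ 0# → ¬ y ≈ 0# → ¬ x * y ≈ 0#
  *-≉0 x≉0 y≉0 xy≈0 with x*y≈0⇒x≈0∨y≈0 xy≈0
  ... | inj₁ x≈0 = x≉0 x≈0
  ... | inj₂ y≈0 = y≉0 y≈0

  -- Translation by `1#` permutes the field, so adding `1#` to each of the `q` elements does not
  -- change their sum.
  q·1≈0 : q · 1# ≈ 0#
  q·1≈0 = +-cancelˡ (∑ id) (q · 1#) 0# (begin
    ∑ id + q · 1#               ≈⟨ +-congˡ (sum-replicate q) ⟨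
    ∑ id + ∑ (λ _ → 1#)         ≈⟨ ∑-∙ id (λ _ → 1#) ⟨
    ∑ (λ x → x + 1#)            ≈⟨ ∑-reindex id (_+ 1#) (_- 1#) +-congʳ +-congʳ
                                     (λ x → trans (+-assoc _ _ _) (trans (+-congˡ (-‿inverseˡ 1#)) (+-identityʳ x)))
                                     (λ x → trans (+-assoc _ _ _) (trans (+-congˡ (-‿inverseʳ 1#)) (+-identityʳ x))) ⟨
    ∑ id                        ≈⟨ +-identityʳ _ ⟨
    ∑ id + 0#                   ∎)
    where
    open Sum +-commutativeMonoid
    open CommutativeMonoidSum +-commutativeMonoid using (sum-replicate)

  m^n·1≈0⇒m·1≈0 : ∀ m n → (m ℕ.^ n) · 1# ≈ 0# → m · 1# ≈ 0#
  m^n·1≈0⇒m·1≈0 m zero    eq = contradiction (trans (sym (+-identityʳ 1#)) eq) 1≉0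
  m^n·1≈0⇒m·1≈0 m (suc n) eq with x*y≈0⇒x≈0∨y≈0 (trans (sym (×1-homo-* m (m ℕ.^ n))) eq)
  ... | inj₁ m≈0   = m≈0
  ... | inj₂ m^n≈0 = m^n·1≈0⇒m·1≈0 m n m^n≈0

  private
    module *-Sum = CommutativeMonoidSum *-commutativeMonoid
    open Sum *-commutativeMonoid using ()
      renaming (∑ to ∏; ∑-cong to ∏-cong; ∑-∙ to ∏-*; ∑-single to ∏-single; ∑-reindex to ∏-reindex)

    infixr 7 _ifZero_else_
    -- Prescribing the factor at zero turns a product over the nonzero elements into one over the
    -- whole carrier, which permutations of the carrier can reindex.
    _ifZero_else_ : Carrier → Carrier → Carrier → Carrier
    y ifZero x else z with x ≟ 0#
    ... | yes _ = y
    ... | no  _ = z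

    ifZero-yes : ∀ {x} y z → x ≈ 0# → y ifZero x else z ≈ y
    ifZero-yes {x} y z x≈0 with x ≟ 0#
    ... | yes _   = refl
    ... | no  x≉0 = contradiction x≈0 x≉0

    ifZero-no : ∀ {x} y z → ¬ x ≈ 0# → y ifZero x else z ≈ z
    ifZero-no {x} y z x≉0 with x ≟ 0#
    ... | yes x≈0 = contradiction x≈0 x≉0
    ... | no  _   = refl

    ifZero-cong : ∀ {x x′ y z z′} → x ≈ x′ → z ≈ z′ → y ifZero x else z ≈ y ifZero x′ else z′
    ifZero-cong {x} {x′} {y} {z} {z′} x≈x′ z≈z′ with x′ ≟ 0#
    ... | yes x′≈0 = ifZero-yes y z (trans x≈x′ x′≈0)
    ... | no  x′≉0 = trans (ifZero-no y z (x′≉0 ∘ trans (sym x≈x′))) z≈z′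

    ∏-≉0 : ∀ {n} (t : Fin n → Carrier) → (∀ i → ¬ t i ≈ 0#) → ¬ *-Sum.sum t ≈ 0#
    ∏-≉0 {zero}  t t≉0 = 1≉0
    ∏-≉0 {suc n} t t≉0 = *-≉0 (t≉0 zero) (∏-≉0 (t ∘ suc) (t≉0 ∘ suc))

    nonzeroPart : Carrier → Carrier
    nonzeroPart y = 1# ifZero y else y

    nonzeroPart-≉0 : ∀ y → ¬ nonzeroPart y ≈ 0#
    nonzeroPart-≉0 y eq with y ≟ 0#
    ... | yes _   = 1≉0 eq
    ... | no  y≉0 = y≉0 eq

    replicate-split : ∀ x → x ^ q ≈ ∏ (1# ifZero_else x) * x
    replicate-split x = begin
      x ^ q                                              ≈⟨ *-Sum.sum-replicate q ⟨
      ∏ (λ _ → x)                                        ≈⟨ ∏-cong split ⟩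
      ∏ (λ y → (1# ifZero y else x) * (x ifZero y else 1#)) ≈⟨ ∏-* (1# ifZero_else x) (x ifZero_else 1#) ⟩
      ∏ (1# ifZero_else x) * ∏ (x ifZero_else 1#)
        ≈⟨ *-congˡ (∏-single {x ifZero_else 1#} (λ eq → ifZero-cong eq refl) 0# λ y → ifZero-no x 1#) ⟩
      ∏ (1# ifZero_else x) * (x ifZero 0# else 1#)       ≈⟨ *-congˡ (ifZero-yes x 1# refl) ⟩
      ∏ (1# ifZero_else x) * x                           ∎
      where
      split : ∀ y → x ≈ (1# ifZero y else x) * (x ifZero y else 1#)
      split y with y ≟ 0#
      ... | yes _ = sym (*-identityˡ x)
      ... | no  _ = sym (*-identityʳ x)

    ∏-nonzero-≈1 : ∀ {x} → ¬ x ≈ 0# → ∏ (1# ifZero_else x) ≈ 1#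
    ∏-nonzero-≈1 {x} x≉0 with x⁻¹ , xx⁻¹≈1 ← ≉0⇒inverse x≉0 =
      *-cancelˡ-≉0 (∏-≉0 (nonzeroPart ∘ from) (nonzeroPart-≉0 ∘ from)) (begin
      ∏ nonzeroPart * ∏ (1# ifZero_else x)          ≈⟨ *-comm _ _ ⟩
      ∏ (1# ifZero_else x) * ∏ nonzeroPart          ≈⟨ ∏-* (1# ifZero_else x) nonzeroPart ⟨
      ∏ (λ y → (1# ifZero y else x) * nonzeroPart y) ≈⟨ ∏-cong scale ⟩
      ∏ (λ y → nonzeroPart (x * y))
        ≈⟨ ∏-reindex {nonzeroPart} (λ eq → ifZero-cong eq eq) (x *_) (x⁻¹ *_) *-congˡ *-congˡ
             (x*y≈1⇒x*yz≈z xx⁻¹≈1) (x*y≈1⇒x*yz≈z (trans (*-comm x⁻¹ x) xx⁻¹≈1)) ⟨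
      ∏ nonzeroPart                                 ≈⟨ *-identityʳ _ ⟨
      ∏ nonzeroPart * 1#                            ∎)
      where
      scale : ∀ y → (1# ifZero y else x) * nonzeroPart y ≈ nonzeroPart (x * y)
      scale y with y ≟ 0#
      ... | yes y≈0 = trans (*-identityˡ 1#) (sym (ifZero-yes 1# (x * y) (trans (*-congˡ y≈0) (zeroʳ x))))
      ... | no  y≉0 = sym (ifZero-no 1# (x * y) (*-≉0 x≉0 y≉0))

  -- The product of x over all y ≠ 0 is 1 because multiplication by x permutes
  -- the nonzero elements; the factor at y = 0 supplies the remaining x.
  fermat : ∀ x → x ^ q ≈ x
  fermat x with x ≟ 0#
  ... | yes x≈0 = trans (replicate-split x) (trans (*-congˡ x≈0) (trans (zeroʳ _) (sym x≈0)))
  ... | no  x≉0 = trans (replicate-split x) (trans (*-congʳ (∏-nonzero-≈1 x≉0)) (*-identityˡ x))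

-- Integer-valued counting on a finite setoid

module FiniteIntegerSum {a ℓ} (S : Setoid a ℓ) {n} (card : HasCardinality S n) where
  open Setoid S
  open Finite S card
  open Sum ℤₚ.+-0-commutativeMonoid renaming (∑-∙ to ∑-+) public
  private module Σℤ = SemiringSum ℤₚ.+-*-semiring
  open ≡.≡-Reasoning

  ∑-*ˡ : ∀ k f → ∑ (λ x → k ℤ.* f x) ≡ k ℤ.* ∑ f
  ∑-*ˡ k f = ≡.sym (Σℤ.*-distribˡ-sum k (f ∘ from))

  ∑-*ʳ : ∀ k f → ∑ (λ x → f x ℤ.* k) ≡ ∑ f ℤ.* k
  ∑-*ʳ k f = ≡.sym (Σℤ.*-distribʳ-sum k (f ∘ from))

  ∑-- : ∀ f g → ∑ (λ x → f x ℤ.- g x) ≡ ∑ f ℤ.- ∑ g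
  ∑-- f g = begin
    ∑ (λ x → f x ℤ.- g x)             ≡⟨ ∑-+ f (λ x → ℤ.- g x) ⟩
    ∑ f ℤ.+ ∑ (λ x → ℤ.- g x)         ≡⟨ cong (ℤ._+_ (∑ f)) (∑-cong λ x → ≡.sym (ℤₚ.-1*i≡-i (g x))) ⟩
    ∑ f ℤ.+ ∑ (λ x → -1ℤ ℤ.* g x)     ≡⟨ cong (ℤ._+_ (∑ f)) (≡.trans (∑-*ˡ -1ℤ g) (ℤₚ.-1*i≡-i (∑ g))) ⟩
    ∑ f ℤ.- ∑ g                       ∎

  ∑-const : ∀ k → ∑ (λ _ → k) ≡ + n ℤ.* k
  ∑-const k = sum-const n
    where
    sum-const : ∀ m → Σℤ.sum {m} (λ _ → k) ≡ + m ℤ.* k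
    sum-const zero    = ≡.refl
    sum-const (suc m) = ≡.trans (cong (ℤ._+_ k) (sum-const m)) (≡.sym (ℤₚ.suc-* (+ m) k))

  ∑-mono-≤-rigid : ∀ {f g} → Congruent f → Congruent g → (∀ x → f x ℤ.≤ g x) → ∑ f ≡ ∑ g → ∀ x → f x ≡ g x
  ∑-mono-≤-rigid f-cong g-cong f≤g eq x = ≡.trans (f-cong (sym (strictlyInverseʳ x)))
    (≡.trans (ℤSum.sum-mono-≤-rigid (f≤g ∘ from) eq (to x)) (g-cong (strictlyInverseʳ x)))

  ∑-∣ : ∀ {k f} → (∀ x → k ∣ᶻ f x) → k ∣ᶻ ∑ f
  ∑-∣ {k} k∣f = sum-∣ (k∣f ∘ from)
    where
    sum-∣ : ∀ {m} {t : Fin m → ℤ} → (∀ i → k ∣ᶻ t i) → k ∣ᶻ Σℤ.sum t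
    sum-∣ {zero}  _   = divides 0ℤ ≡.refl
    sum-∣ {suc m} k∣t = ∣m∣n⇒∣m+n (k∣t zero) (sum-∣ (k∣t ∘ suc))

  δ : Carrier → Carrier → ℤ
  δ x y = ⟦ x ≟ y ⟧

  δ-yes : ∀ {x y} → x ≈ y → δ x y ≡ 1ℤ
  δ-yes {x} {y} = ⟦⟧-yes (x ≟ y)

  δ-no : ∀ {x y} → ¬ x ≈ y → δ x y ≡ 0ℤ
  δ-no {x} {y} = ⟦⟧-no (x ≟ y)

  δ-⇔ : ∀ {x y u v} → (x ≈ y → u ≈ v) → (u ≈ v → x ≈ y) → δ x y ≡ δ u v
  δ-⇔ {x} {y} {u} {v} = ⟦⟧-cong (x ≟ y) (u ≟ v)

  δ-cong : ∀ {x y u v} → x ≈ u → y ≈ v → δ x y ≡ δ u v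
  δ-cong x≈u y≈v = δ-⇔ (λ x≈y → trans (sym x≈u) (trans x≈y y≈v)) (λ u≈v → trans x≈u (trans u≈v (sym y≈v)))

  δ-sym : ∀ x y → δ x y ≡ δ y x
  δ-sym x y = δ-⇔ sym sym

  ∑-δ* : ∀ {h} → Congruent h → ∀ a → ∑ (λ x → δ x a ℤ.* h x) ≡ h a
  ∑-δ* {h} h-cong a = begin
    ∑ (λ x → δ x a ℤ.* h x)     ≡⟨ ∑-single (λ x≈y → cong₂ ℤ._*_ (δ-cong x≈y refl) (h-cong x≈y)) a
                                     (λ y y≉a → cong (ℤ._* h y) (δ-no y≉a)) ⟩
    δ a a ℤ.* h a               ≡⟨ cong (ℤ._* h a) (δ-yes refl) ⟩
    1ℤ ℤ.* h a                  ≡⟨ ℤₚ.*-identityˡ (h a) ⟩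
    h a                         ∎

  ∑-δ : ∀ a → ∑ (λ x → δ x a) ≡ 1ℤ
  ∑-δ a = ≡.trans (∑-cong λ x → ≡.sym (ℤₚ.*-identityʳ (δ x a))) (∑-δ* {λ _ → 1ℤ} (λ _ → ≡.refl) a)

  fibre : (Carrier → Carrier) → Carrier → ℤ
  fibre g w = ∑ λ x → δ (g x) w

  fibre-cong : ∀ g → Congruent (fibre g)
  fibre-cong g v≈w = ∑-cong λ x → δ-cong (refl {g x}) v≈w

  -- Double counting of pairs `(x , w)` with `g x ≈ w`. It is the change of variables for maps that
  -- are not bijective, here squaring and `L`.
  ∑-fibre : ∀ g {h} → Congruent h → ∑ (λ w → fibre g w ℤ.* h w) ≡ ∑ (h ∘ g)
  ∑-fibre g {h} h-cong = begin
    ∑ (λ w → fibre g w ℤ.* h w)                  ≡⟨ ∑-cong (λ w → ≡.sym (∑-*ʳ (h w) (λ x → δ (g x) w))) ⟩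
    ∑ (λ w → ∑ λ x → δ (g x) w ℤ.* h w)          ≡⟨ ∑-swap (λ w x → δ (g x) w ℤ.* h w) ⟩
    ∑ (λ x → ∑ λ w → δ (g x) w ℤ.* h w)          ≡⟨ ∑-cong (λ x → ∑-cong λ w → cong (ℤ._* h w) (δ-sym (g x) w)) ⟩
    ∑ (λ x → ∑ λ w → δ w (g x) ℤ.* h w)          ≡⟨ ∑-cong (λ x → ∑-δ* h-cong (g x)) ⟩
    ∑ (h ∘ g)                                    ∎

  ∑-fibre-1 : ∀ g → ∑ (fibre g) ≡ + n
  ∑-fibre-1 g = begin
    ∑ (fibre g)                     ≡⟨ ∑-cong (λ w → ≡.sym (ℤₚ.*-identityʳ (fibre g w))) ⟩
    ∑ (λ w → fibre g w ℤ.* 1ℤ)      ≡⟨ ∑-fibre g {λ _ → 1ℤ} (λ _ → ≡.refl) ⟩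
    ∑ (λ _ → 1ℤ)                    ≡⟨ ≡.trans (∑-const 1ℤ) (ℤₚ.*-identityʳ (+ n)) ⟩
    + n                             ∎

  -- The points other than the fixed point z are paired off by σ; the one with
  -- the smaller number represents its pair.
  ∑-involution-∣ : ∀ {f k z} (σ : Carrier → Carrier) → (∀ {x y} → x ≈ y → σ x ≈ σ y) → (∀ x → σ (σ x) ≈ x) →
                   (∀ x → σ x ≈ x → x ≈ z) → σ z ≈ z →
                   Congruent f → (∀ x → f (σ x) ≡ f x) → (∀ x → ¬ x ≈ z → k ∣ᶻ f x) →
                   + 2 ℤ.* k ∣ᶻ ∑ f ℤ.- f z
  ∑-involution-∣ {f} {k} {z} σ σ-cong σσ fixed σz f-cong fσ k∣f = ≡.subst (+ 2 ℤ.* k ∣ᶻ_) split 2k∣2∑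
    where
    less : Carrier → Carrier → ℤ
    less x y = ⟦ toℕ (to x) ℕₚ.<? toℕ (to y) ⟧

    less-cong : ∀ {x y u v} → x ≈ u → y ≈ v → less x y ≡ less u v
    less-cong x≈u y≈v rewrite to-cong x≈u | to-cong y≈v = ≡.refl

    z-fixed : ∀ {x} → x ≈ z → x ≈ σ x
    z-fixed x≈z = trans x≈z (trans (sym σz) (σ-cong (sym x≈z)))

    half : Carrier → ℤ
    half x = f x ℤ.* less x (σ x)

    half-cong : Congruent half
    half-cong x≈y = cong₂ ℤ._*_ (f-cong x≈y) (less-cong x≈y (σ-cong x≈y))

    k∣half : ∀ x → k ∣ᶻ half x
    k∣half x with x ≟ z
    ... | yes x≈z = divides 0ℤ
      (≡.trans (cong (f x ℤ.*_) (⟦⟧-no (_ ℕₚ.<? _) (ℕₚ.<-irrefl (cong toℕ (to-cong (z-fixed x≈z))))))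
        (ℤₚ.*-zeroʳ (f x)))
    ... | no x≉z with divides c eq ← k∣f x x≉z = divides (c ℤ.* less x (σ x))
      (≡.trans (cong (ℤ._* less x (σ x)) eq) (solveℤ 3 (λ c k l → c ⊗ k ⊗ l ⊜ c ⊗ l ⊗ k) ≡.refl c k (less x (σ x))))

    2k∣2∑ : + 2 ℤ.* k ∣ᶻ + 2 ℤ.* ∑ half
    2k∣2∑ with divides c eq ← ∑-∣ {k} {half} k∣half = divides c
      (≡.trans (cong (+ 2 ℤ.*_) eq) (solveℤ 2 (λ c k → κ (+ 2) ⊗ (c ⊗ k) ⊜ c ⊗ (κ (+ 2) ⊗ k)) ≡.refl c k))

    trichotomy : ∀ x → less x (σ x) ℤ.+ less (σ x) (σ (σ x)) ℤ.+ δ x z ≡ 1ℤ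
    trichotomy x rewrite less-cong {σ x} refl (σσ x) with ℕₚ.<-cmp (toℕ (to x)) (toℕ (to (σ x)))
    ... | tri< x<σx x≢σx σx≮x = cong₂ ℤ._+_
      (cong₂ ℤ._+_ (⟦⟧-yes (_ ℕₚ.<? _) x<σx) (⟦⟧-no (_ ℕₚ.<? _) σx≮x))
      (δ-no λ x≈z → x≢σx (cong toℕ (to-cong (z-fixed x≈z))))
    ... | tri≈ x≮σx x≡σx σx≮x = cong₂ ℤ._+_
      (cong₂ ℤ._+_ (⟦⟧-no (_ ℕₚ.<? _) x≮σx) (⟦⟧-no (_ ℕₚ.<? _) σx≮x))
      (δ-yes (fixed x (sym (to-injective (Fin.toℕ-injective x≡σx)))))
    ... | tri> x≮σx x≢σx σx<x = cong₂ ℤ._+_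
      (cong₂ ℤ._+_ (⟦⟧-no (_ ℕₚ.<? _) x≮σx) (⟦⟧-yes (_ ℕₚ.<? _) σx<x))
      (δ-no λ x≈z → x≢σx (cong toℕ (to-cong (z-fixed x≈z))))

    split : + 2 ℤ.* ∑ half ≡ ∑ f ℤ.- f z
    split = begin
      + 2 ℤ.* ∑ half
        ≡⟨ solveℤ 2 (λ h e → κ (+ 2) ⊗ h ⊜ h ⊕ h ⊕ e ⊖ e) ≡.refl (∑ half) (f z) ⟩
      ∑ half ℤ.+ ∑ half ℤ.+ f z ℤ.- f z
        ≡⟨ cong (ℤ._- f z) (cong₂ ℤ._+_ (cong (ℤ._+_ (∑ half)) (∑-reindex half-cong σ σ σ-cong σ-cong σσ σσ))
             (≡.sym (∑-δ* f-cong z))) ⟩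
      ∑ half ℤ.+ ∑ (half ∘ σ) ℤ.+ ∑ (λ x → δ x z ℤ.* f x) ℤ.- f z
        ≡⟨ cong (ℤ._- f z) (≡.trans (∑-+ (λ x → half x ℤ.+ half (σ x)) (λ x → δ x z ℤ.* f x))
             (cong (ℤ._+ ∑ (λ x → δ x z ℤ.* f x)) (∑-+ half (half ∘ σ)))) ⟨
      ∑ (λ x → half x ℤ.+ half (σ x) ℤ.+ δ x z ℤ.* f x) ℤ.- f z
        ≡⟨ cong (ℤ._- f z) (∑-cong collect) ⟩
      ∑ f ℤ.- f z ∎
      where
      collect : ∀ x → half x ℤ.+ half (σ x) ℤ.+ δ x z ℤ.* f x ≡ f x
      collect x = begin
        f x ℤ.* less x (σ x) ℤ.+ f (σ x) ℤ.* less (σ x) (σ (σ x)) ℤ.+ δ x z ℤ.* f x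
          ≡⟨ cong (λ e → f x ℤ.* less x (σ x) ℤ.+ e ℤ.* less (σ x) (σ (σ x)) ℤ.+ δ x z ℤ.* f x) (fσ x) ⟩
        f x ℤ.* less x (σ x) ℤ.+ f x ℤ.* less (σ x) (σ (σ x)) ℤ.+ δ x z ℤ.* f x
          ≡⟨ solveℤ 4 (λ f a b e → f ⊗ a ⊕ f ⊗ b ⊕ e ⊗ f ⊜ (a ⊕ b ⊕ e) ⊗ f) ≡.refl (f x) _ _ (δ x z) ⟩
        (less x (σ x) ℤ.+ less (σ x) (σ (σ x)) ℤ.+ δ x z) ℤ.* f x
          ≡⟨ cong (ℤ._* f x) (trichotomy x) ⟩
        1ℤ ℤ.* f x
          ≡⟨ ℤₚ.*-identityˡ (f x) ⟩
        f x ∎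

-- Counting square roots; the quadratic character

module SquareCounting {c ℓ₁ ℓ₂} (K : HeytingField c ℓ₁ ℓ₂) {q} (card : HasCardinality (HeytingField.setoid K) q)
  (3≈0 : HasCharacteristic3 (HeytingCommutativeRing.commutativeRing (HeytingField.heytingCommutativeRing K))) where
  open HeytingCommutativeRing (HeytingField.heytingCommutativeRing K) using (commutativeRing)
  open CommutativeRing commutativeRing hiding (zero)
  open FiniteField K card
  open FiniteIntegerSum setoid card
  open Characteristic3 commutativeRing 3≈0
  private module R = SetoidReasoning setoid
  open ≡.≡-Reasoning

  square-injective : ∀ {y s} → y * y ≈ s * s → y ≈ s ⊎ y ≈ - s
  square-injective {y} {s} eq with x*y≈0⇒x≈0∨y≈0 (R.begin
    (y - s) * (y + s)    R.≈⟨ solve 2 (λ y s → (y :- s) :* (y :+ s) := y :* y :- s :* s) refl y s ⟩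
    y * y - s * s        R.≈⟨ +-congʳ eq ⟩
    s * s - s * s        R.≈⟨ -‿inverseʳ _ ⟩
    0#                   R.∎)
  ... | inj₁ y-s≈0 = inj₁ (x-y≈0⇒x≈y y-s≈0)
  ... | inj₂ y+s≈0 = inj₂ (x-y≈0⇒x≈y (trans (solve 2 (λ y s → y :- (:- s) := y :+ s) refl y s) y+s≈0))

  s≈-s⇒s≈0 : ∀ {s} → s ≈ - s → s ≈ 0#
  s≈-s⇒s≈0 {s} s≈-s = R.begin
    s               R.≈⟨ solve 1 (λ s → s := :- (s :+ s)) refl s ⟩
    - (s + s)       R.≈⟨ -‿cong (+-congˡ s≈-s) ⟩
    - (s - s)       R.≈⟨ solve 1 (λ s → :- (s :- s) := con 0₃) refl s ⟩
    0#              R.∎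

  N : Carrier → ℤ
  N = fibre (λ y → y * y)

  N-cong : Congruent N
  N-cong = fibre-cong (λ y → y * y)

  -- The quadratic character: 0 at zero, 1 at nonzero squares and -1 at nonsquares. Defining it
  -- through `N` reduces character sums to counts of solutions.
  χ : Carrier → ℤ
  χ w = N w ℤ.- 1ℤ

  χ-cong : Congruent χ
  χ-cong x≈y = cong (ℤ._- 1ℤ) (N-cong x≈y)

  N-0 : N 0# ≡ 1ℤ
  N-0 = ≡.trans (∑-cong λ y → δ-⇔ y²≈0⇒y≈0 λ y≈0 → trans (*-congʳ y≈0) (zeroˡ y)) (∑-δ 0#)
    where
    y²≈0⇒y≈0 : ∀ {y} → y * y ≈ 0# → y ≈ 0#
    y²≈0⇒y≈0 y²≈0 with x*y≈0⇒x≈0∨y≈0 y²≈0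
    ... | inj₁ y≈0 = y≈0
    ... | inj₂ y≈0 = y≈0

  N-square : ∀ {s} → ¬ s ≈ 0# → N (s * s) ≡ + 2
  N-square {s} s≉0 = begin
    N (s * s)                                           ≡⟨ ∑-cong two-roots ⟩
    ∑ (λ y → δ y s ℤ.+ δ y (- s))                       ≡⟨ ∑-+ (λ y → δ y s) (λ y → δ y (- s)) ⟩
    ∑ (λ y → δ y s) ℤ.+ ∑ (λ y → δ y (- s))             ≡⟨ cong₂ ℤ._+_ (∑-δ s) (∑-δ (- s)) ⟩
    + 2                                                 ∎
    where
    two-roots : ∀ y → δ (y * y) (s * s) ≡ δ y s ℤ.+ δ y (- s)
    two-roots y with y ≟ s | y ≟ - s
    ... | yes y≈s | yes y≈-s = contradiction (s≈-s⇒s≈0 (trans (sym y≈s) y≈-s)) s≉0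
    ... | yes y≈s | no  _    = δ-yes (*-cong y≈s y≈s)
    ... | no  _   | yes y≈-s = δ-yes (trans (*-cong y≈-s y≈-s) (solve 1 (λ s → :- s :* :- s := s :* s) refl s))
    ... | no  y≉s | no  y≉-s = δ-no λ eq → case (square-injective {y} {s} eq)
      where
      case : y ≈ s ⊎ y ≈ - s → _
      case (inj₁ y≈s)  = y≉s y≈s
      case (inj₂ y≈-s) = y≉-s y≈-s

  Square : Carrier → Set _
  Square w = ∃[ y ] y * y ≈ w

  square? : ∀ w → Dec (Square w)
  square? w = decide∃ (λ y≈z y²≈w → trans (*-cong (sym y≈z) (sym y≈z)) y²≈w) (λ y → y * y ≟ w)

  N-nonsquare : ∀ {w} → ¬ Square w → N w ≡ 0ℤ
  N-nonsquare ¬sq = ≡.trans (∑-cong λ y → δ-no λ y²≈w → ¬sq (y , y²≈w)) (≡.trans (∑-const 0ℤ) (ℤₚ.*-zeroʳ (+ q)))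

  data Roots (w : Carrier) : Set (c ⊔ ℓ₁) where
    one  : w ≈ 0# → N w ≡ 1ℤ → Roots w
    two  : ∀ s → ¬ s ≈ 0# → s * s ≈ w → N w ≡ + 2 → Roots w
    none : ¬ Square w → N w ≡ 0ℤ → Roots w

  roots : ∀ w → Roots w
  roots w with square? w
  ... | no ¬sq = none ¬sq (N-nonsquare ¬sq)
  ... | yes (s , s²≈w) with s ≟ 0#
  ...   | yes s≈0 = one w≈0 (≡.trans (N-cong w≈0) N-0)
    where w≈0 = trans (sym s²≈w) (trans (*-congʳ s≈0) (zeroˡ s))
  ...   | no  s≉0 = two s s≉0 s²≈w (≡.trans (N-cong (sym s²≈w)) (N-square s≉0))

  N-≤2 : ∀ w → N w ℤ.≤ + 2
  N-≤2 w with roots w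
  ... | one _ eq     = ≡.subst (ℤ._≤ + 2) (≡.sym eq) (ℤ.+≤+ (s≤s z≤n))
  ... | two _ _ _ eq = ≡.subst (ℤ._≤ + 2) (≡.sym eq) ℤₚ.≤-refl
  ... | none _ eq    = ≡.subst (ℤ._≤ + 2) (≡.sym eq) (ℤ.+≤+ z≤n)

  2∣N : ∀ {w} → ¬ w ≈ 0# → + 2 ∣ᶻ N w
  2∣N {w} w≉0 with roots w
  ... | one w≈0 _    = contradiction w≈0 w≉0
  ... | two _ _ _ eq = divides 1ℤ eq
  ... | none _ eq    = divides 0ℤ eq

  -- Multiplication by `s` carries the roots of `w` bijectively to those of `s * s * w`. With
  -- `N-twist` this stands in for multiplicativity of the quadratic character.
  N-scale : ∀ {s} → ¬ s ≈ 0# → ∀ w → N (s * s * w) ≡ N w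
  N-scale {s} s≉0 w with s⁻¹ , ss⁻¹≈1 ← ≉0⇒inverse s≉0 = begin
    ∑ (λ y → δ (y * y) (s * s * w))
      ≡⟨ ∑-reindex {λ y → δ (y * y) (s * s * w)} (λ x≈y → δ-cong (*-cong x≈y x≈y) refl)
           (s *_) (s⁻¹ *_) *-congˡ *-congˡ
           (x*y≈1⇒x*yz≈z ss⁻¹≈1) (x*y≈1⇒x*yz≈z (trans (*-comm _ _) ss⁻¹≈1)) ⟩
    ∑ (λ y → δ (s * y * (s * y)) (s * s * w))
      ≡⟨ ∑-cong (λ y → δ-⇔
           (λ eq → *-cancelˡ-≉0 (*-≉0 s≉0 s≉0) (trans (interchange y) eq))
           (λ eq → trans (sym (interchange y)) (*-congˡ eq))) ⟩
    ∑ (λ y → δ (y * y) w)                          ∎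
    where
    interchange : ∀ y → s * s * (y * y) ≈ s * y * (s * y)
    interchange = solve 2 (λ s y → s :* s :* (y :* y) := s :* y :* (s :* y)) refl s

  ∑-N : ∑ N ≡ + q
  ∑-N = ∑-fibre-1 (λ y → y * y)

  ∑-N-+ : ∀ a → ∑ (λ w → N (w + a)) ≡ + q
  ∑-N-+ a = ≡.trans (≡.sym (∑-reindex N-cong (_+ a) (_- a) +-congʳ +-congʳ
    (λ x → solve 2 (λ x a → x :- a :+ a := x) refl x a) (λ x → solve 2 (λ x a → x :+ a :- a := x) refl x a))) ∑-N

  -- Only the bound by 2 is checked pointwise: if `w` is a nonzero square then `γ * w` has no root,
  -- and if `w` has no root then `N (γ * w)` is at most 2 anyway. Multiplication by `γ` permutes the
  -- field, so both sides sum to `2 q` and equality holds everywhere.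
  N-twist : ∀ {γ} → ¬ Square γ → ∀ w → N (γ * w) ℤ.+ N w ≡ + 2
  N-twist {γ} ¬sq = ∑-mono-≤-rigid (λ x≈y → cong₂ ℤ._+_ (N-cong (*-congˡ x≈y)) (N-cong x≈y)) (λ _ → ≡.refl) bound sums
    where
    γ≉0 : ¬ γ ≈ 0#
    γ≉0 γ≈0 = ¬sq (0# , trans (zeroˡ 0#) (sym γ≈0))

    bound : ∀ w → N (γ * w) ℤ.+ N w ℤ.≤ + 2
    bound w with roots w
    ... | one w≈0 eq = ℤₚ.≤-reflexive (cong₂ ℤ._+_ (≡.trans (N-cong (trans (*-congˡ w≈0) (zeroʳ γ))) N-0) eq)
    ... | two s s≉0 s²≈w eq = ℤₚ.≤-reflexive (cong₂ ℤ._+_ (begin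
      N (γ * w)         ≡⟨ N-cong (trans (*-comm γ w) (*-congʳ (sym s²≈w))) ⟩
      N (s * s * γ)     ≡⟨ N-scale s≉0 γ ⟩
      N γ               ≡⟨ N-nonsquare ¬sq ⟩
      0ℤ                ∎) eq)
    ... | none _ eq =
      ≡.subst (ℤ._≤ + 2) (≡.sym (≡.trans (cong (ℤ._+_ (N (γ * w))) eq) (ℤₚ.+-identityʳ _))) (N-≤2 (γ * w))

    sums : ∑ (λ w → N (γ * w) ℤ.+ N w) ≡ ∑ (λ _ → + 2)
    sums with γ⁻¹ , γγ⁻¹≈1 ← ≉0⇒inverse γ≉0 = begin
      ∑ (λ w → N (γ * w) ℤ.+ N w)          ≡⟨ ∑-+ (λ w → N (γ * w)) N ⟩
      ∑ (λ w → N (γ * w)) ℤ.+ ∑ N          ≡⟨ cong (ℤ._+ ∑ N) (∑-reindex N-cong (γ *_) (γ⁻¹ *_) *-congˡ *-congˡ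
                                                (x*y≈1⇒x*yz≈z γγ⁻¹≈1) (x*y≈1⇒x*yz≈z (trans (*-comm _ _) γγ⁻¹≈1))) ⟨
      ∑ N ℤ.+ ∑ N                          ≡⟨ cong₂ ℤ._+_ ∑-N ∑-N ⟩
      + q ℤ.+ + q                          ≡⟨ solveℤ 1 (λ q → q ⊕ q ⊜ q ⊗ κ (+ 2)) ≡.refl (+ q) ⟩
      + q ℤ.* + 2                          ≡⟨ ∑-const (+ 2) ⟨
      ∑ (λ _ → + 2)                        ∎

-- Conics, the Artin-Schreier map and the second moment of `S`

module ArtinSchreierSum {c ℓ₁ ℓ₂} (K : HeytingField c ℓ₁ ℓ₂) {q} (card : HasCardinality (HeytingField.setoid K) q)
  (3≈0 : HasCharacteristic3 (HeytingCommutativeRing.commutativeRing (HeytingField.heytingCommutativeRing K))) where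
  open HeytingCommutativeRing (HeytingField.heytingCommutativeRing K) using (commutativeRing)
  open CommutativeRing commutativeRing hiding (zero)
  open FiniteField K card
  open FiniteIntegerSum setoid card
  open Characteristic3 commutativeRing 3≈0
  open SquareCounting K card 3≈0
  private module R = SetoidReasoning setoid
  open ≡.≡-Reasoning

  -- The substitution t = x - u turns t² = u² + a into (x + u) x = a, which is
  -- linear in u.
  N-conic : ∀ u a → N (u * u + a) ≡ ∑ λ x → δ ((x + u) * x) a
  N-conic u a = begin
    ∑ (λ t → δ (t * t) (u * u + a))
      ≡⟨ ∑-reindex {λ t → δ (t * t) (u * u + a)} (λ x≈y → δ-cong (*-cong x≈y x≈y) refl)
           (_- u) (_+ u) +-congʳ +-congʳ
           (λ x → solve 2 (λ x u → x :+ u :- u := x) refl x u)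
           (λ x → solve 2 (λ x u → x :- u :+ u := x) refl x u) ⟩
    ∑ (λ x → δ ((x - u) * (x - u)) (u * u + a))        ≡⟨ ∑-cong (λ x → δ-⇔ (forth x) (back x)) ⟩
    ∑ (λ x → δ ((x + u) * x) a)                        ∎
    where
    forth : ∀ x → (x - u) * (x - u) ≈ u * u + a → (x + u) * x ≈ a
    forth x eq = R.begin
      (x + u) * x
        R.≈⟨ solve 2 (λ x u → (x :+ u) :* x := (x :- u) :* (x :- u) :- u :* u) refl x u ⟩
      (x - u) * (x - u) - u * u           R.≈⟨ +-congʳ eq ⟩
      u * u + a - u * u                   R.≈⟨ solve 2 (λ a v → v :+ a :- v := a) refl a (u * u) ⟩
      a                                   R.∎
    back : ∀ x → (x + u) * x ≈ a → (x - u) * (x - u) ≈ u * u + a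
    back x eq = R.begin
      (x - u) * (x - u)
        R.≈⟨ solve 2 (λ x u → (x :- u) :* (x :- u) := u :* u :+ (x :+ u) :* x) refl x u ⟩
      u * u + (x + u) * x                 R.≈⟨ +-congˡ eq ⟩
      u * u + a                           R.∎

  ∑-N-conic : ∀ (h : Carrier → ℤ) a → ∑ (λ u → h u ℤ.* N (u * u + a)) ≡ ∑ (λ x → ∑ λ u → h u ℤ.* δ ((x + u) * x) a)
  ∑-N-conic h a = ≡.trans
    (∑-cong λ u →
      ≡.trans (cong (h u ℤ.*_) (N-conic u a)) (≡.sym (∑-*ˡ (h u) λ x → δ ((x + u) * x) a)))
    (∑-swap λ u x → h u ℤ.* δ ((x + u) * x) a)

  ∑-hyperbola : ∀ {h} → Congruent h → ∀ {x x⁻¹} → ¬ x ≈ 0# → x * x⁻¹ ≈ 1# → ∀ a →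
                ∑ (λ u → h u ℤ.* δ ((x + u) * x) a) ≡ h (a * x⁻¹ - x)
  ∑-hyperbola {h} h-cong {x} {x⁻¹} x≉0 xx⁻¹≈1 a = ≡.trans
    (∑-cong λ u → ≡.trans (ℤₚ.*-comm (h u) (δ ((x + u) * x) a)) (cong (ℤ._* h u) (δ-⇔ (forth u) (back u))))
    (∑-δ* h-cong (a * x⁻¹ - x))
    where
    forth : ∀ u → (x + u) * x ≈ a → u ≈ a * x⁻¹ - x
    forth u eq = R.begin
      u                                   R.≈⟨ solve 2 (λ x u → u := (x :+ u) :* con 1₃ :- x) refl x u ⟩
      (x + u) * 1# - x                    R.≈⟨ +-congʳ (*-congˡ xx⁻¹≈1) ⟨
      (x + u) * (x * x⁻¹) - x             R.≈⟨ +-congʳ (*-assoc _ _ _) ⟨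
      (x + u) * x * x⁻¹ - x               R.≈⟨ +-congʳ (*-congʳ eq) ⟩
      a * x⁻¹ - x                         R.∎
    back : ∀ u → u ≈ a * x⁻¹ - x → (x + u) * x ≈ a
    back u eq = R.begin
      (x + u) * x                         R.≈⟨ *-congʳ (+-congˡ eq) ⟩
      (x + (a * x⁻¹ - x)) * x
        R.≈⟨ solve 3 (λ x y a → (x :+ (a :* y :- x)) :* x := a :* (x :* y)) refl x x⁻¹ a ⟩
      a * (x * x⁻¹)                       R.≈⟨ *-congˡ xx⁻¹≈1 ⟩
      a * 1#                              R.≈⟨ *-identityʳ a ⟩
      a                                   R.∎

  -- In the coordinates of `N-conic`, each `x ≠ 0` carries exactly one `u`, while `x = 0` carries
  -- all `q` of them or none according to whether `a` is zero.
  conic-count : ∀ a → ∑ (λ u → N (u * u + a)) ≡ + q ℤ.- 1ℤ ℤ.+ + q ℤ.* δ a 0#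
  conic-count a = begin
    ∑ (λ u → N (u * u + a))                                      ≡⟨ ∑-cong (λ u → ℤₚ.*-identityˡ (N (u * u + a))) ⟨
    ∑ (λ u → 1ℤ ℤ.* N (u * u + a))                               ≡⟨ ∑-N-conic (λ _ → 1ℤ) a ⟩
    ∑ (λ x → ∑ λ u → 1ℤ ℤ.* δ ((x + u) * x) a)                   ≡⟨ ∑-cong column ⟩
    ∑ (λ x → 1ℤ ℤ.+ δ x 0# ℤ.* k)                                ≡⟨ ∑-+ (λ _ → 1ℤ) (λ x → δ x 0# ℤ.* k) ⟩
    ∑ (λ _ → 1ℤ) ℤ.+ ∑ (λ x → δ x 0# ℤ.* k)
      ≡⟨ cong₂ ℤ._+_ (∑-const 1ℤ) (∑-δ* {λ _ → k} (λ _ → ≡.refl) 0#) ⟩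
    + q ℤ.* 1ℤ ℤ.+ k
      ≡⟨ solveℤ 2 (λ q d → q ⊗ κ 1ℤ ⊕ (q ⊗ d ⊖ κ 1ℤ) ⊜ q ⊖ κ 1ℤ ⊕ q ⊗ d)
           ≡.refl (+ q) (δ a 0#) ⟩
    + q ℤ.- 1ℤ ℤ.+ + q ℤ.* δ a 0#                                ∎
    where
    -- The excess of the column at `x = 0` over the value 1 of every other column.
    k = + q ℤ.* δ a 0# ℤ.- 1ℤ
    column : ∀ x → ∑ (λ u → 1ℤ ℤ.* δ ((x + u) * x) a) ≡ 1ℤ ℤ.+ δ x 0# ℤ.* k
    column x with x ≟ 0#
    ... | no x≉0 with x⁻¹ , xx⁻¹≈1 ← ≉0⇒inverse x≉0 = ∑-hyperbola {λ _ → 1ℤ} (λ _ → ≡.refl) x≉0 xx⁻¹≈1 a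
    ... | yes x≈0 = begin
      ∑ (λ u → 1ℤ ℤ.* δ ((x + u) * x) a)     ≡⟨ ∑-cong (λ u → ≡.trans (ℤₚ.*-identityˡ (δ ((x + u) * x) a)) (≡.trans
                                                  (δ-cong (trans (*-congˡ x≈0) (zeroʳ _)) refl) (δ-sym 0# a))) ⟩
      ∑ (λ u → δ a 0#)                       ≡⟨ ∑-const (δ a 0#) ⟩
      + q ℤ.* δ a 0#
        ≡⟨ solveℤ 1 (λ k → k ⊜ κ 1ℤ ⊕ κ 1ℤ ⊗ (k ⊖ κ 1ℤ)) ≡.refl (+ q ℤ.* δ a 0#) ⟩
      1ℤ ℤ.+ 1ℤ ℤ.* k                        ∎

  -- After `χ = N - 1` is expanded, the linear terms have known sums. In the product term, writing
  -- `z = y * y` turns the sum into the number of points on the conic `t² = y² + a`.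
  χ-correlation : ∀ a → ∑ (λ z → χ z ℤ.* χ (z + a)) ≡ + q ℤ.* δ a 0# ℤ.- 1ℤ
  χ-correlation a = begin
    ∑ (λ z → χ z ℤ.* χ (z + a))
      ≡⟨ ∑-cong (λ z → solveℤ 2 (λ m n → (m ⊖ κ 1ℤ) ⊗ (n ⊖ κ 1ℤ) ⊜ m ⊗ n ⊖ (m ⊕ n ⊖ κ 1ℤ)) ≡.refl (N z) (N (z + a))) ⟩
    ∑ (λ z → N z ℤ.* N (z + a) ℤ.- (N z ℤ.+ N (z + a) ℤ.- 1ℤ))
      ≡⟨ ∑-- (λ z → N z ℤ.* N (z + a)) (λ z → N z ℤ.+ N (z + a) ℤ.- 1ℤ) ⟩
    ∑ (λ z → N z ℤ.* N (z + a)) ℤ.- ∑ (λ z → N z ℤ.+ N (z + a) ℤ.- 1ℤ)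
      ≡⟨ cong₂ ℤ._-_ (≡.trans (∑-fibre (λ y → y * y) {λ z → N (z + a)} (N-cong ∘ +-congʳ)) (conic-count a)) linear ⟩
    + q ℤ.- 1ℤ ℤ.+ + q ℤ.* δ a 0# ℤ.- + q
      ≡⟨ solveℤ 2 (λ q d → q ⊖ κ 1ℤ ⊕ q ⊗ d ⊖ q ⊜ q ⊗ d ⊖ κ 1ℤ) ≡.refl (+ q) (δ a 0#) ⟩
    + q ℤ.* δ a 0# ℤ.- 1ℤ ∎
    where
    linear : ∑ (λ z → N z ℤ.+ N (z + a) ℤ.- 1ℤ) ≡ + q
    linear = begin
      ∑ (λ z → N z ℤ.+ N (z + a) ℤ.- 1ℤ)                ≡⟨ ∑-- (λ z → N z ℤ.+ N (z + a)) (λ _ → 1ℤ) ⟩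
      ∑ (λ z → N z ℤ.+ N (z + a)) ℤ.- ∑ (λ _ → 1ℤ)
        ≡⟨ cong₂ ℤ._-_ (≡.trans (∑-+ N (λ z → N (z + a))) (cong₂ ℤ._+_ ∑-N (∑-N-+ a))) (∑-const 1ℤ) ⟩
      + q ℤ.+ + q ℤ.- + q ℤ.* 1ℤ
        ≡⟨ solveℤ 1 (λ q → q ⊕ q ⊖ q ⊗ κ 1ℤ ⊜ q) ≡.refl (+ q) ⟩
      + q                                               ∎

  χ-orthogonality : ∀ u v → ∑ (λ w → χ (u + w) ℤ.* χ (v + w)) ≡ + q ℤ.* δ u v ℤ.- 1ℤ
  χ-orthogonality u v = begin
    ∑ (λ w → χ (u + w) ℤ.* χ (v + w))
      ≡⟨ ∑-reindex {λ w → χ (u + w) ℤ.* χ (v + w)} (λ x≈y → cong₂ ℤ._*_ (χ-cong (+-congˡ x≈y)) (χ-cong (+-congˡ x≈y)))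
           (_- u) (_+ u) +-congʳ +-congʳ
           (λ x → solve 2 (λ x u → x :+ u :- u := x) refl x u) (λ x → solve 2 (λ x u → x :- u :+ u := x) refl x u) ⟩
    ∑ (λ z → χ (u + (z - u)) ℤ.* χ (v + (z - u)))
      ≡⟨ ∑-cong (λ z → cong₂ ℤ._*_ (χ-cong (solve 2 (λ u z → u :+ (z :- u) := z) refl u z))
                                   (χ-cong (solve 3 (λ u v z → v :+ (z :- u) := z :+ (v :- u)) refl u v z))) ⟩
    ∑ (λ z → χ z ℤ.* χ (z + (v - u)))
      ≡⟨ χ-correlation (v - u) ⟩
    + q ℤ.* δ (v - u) 0# ℤ.- 1ℤ
      ≡⟨ cong (λ e → + q ℤ.* e ℤ.- 1ℤ) (δ-⇔ (λ eq → sym (x-y≈0⇒x≈y eq))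
             (λ eq → trans (+-congˡ (-‿cong eq)) (-‿inverseʳ v))) ⟩
    + q ℤ.* δ u v ℤ.- 1ℤ ∎

  L : Carrier → Carrier
  L x = x * x * x - x

  L-cong : ∀ {x y} → x ≈ y → L x ≈ L y
  L-cong x≈y = +-cong (*-cong (*-cong x≈y x≈y) x≈y) (-‿cong x≈y)

  -- L y - L x = (y - x) (y - x - 1) (y - x + 1), so the fibres of L are the cosets of 𝔽₃.
  L-fibre : ∀ x → fibre L (L x) ≡ + 3
  L-fibre x = begin
    ∑ (λ y → δ (L y) (L x))                                            ≡⟨ ∑-cong three-roots ⟩
    ∑ (λ y → δ y x ℤ.+ δ y (x + 1#) ℤ.+ δ y (x - 1#))
      ≡⟨ ∑-+ (λ y → δ y x ℤ.+ δ y (x + 1#)) (λ y → δ y (x - 1#)) ⟩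
    ∑ (λ y → δ y x ℤ.+ δ y (x + 1#)) ℤ.+ ∑ (λ y → δ y (x - 1#))
      ≡⟨ cong (ℤ._+ ∑ (λ y → δ y (x - 1#))) (∑-+ (λ y → δ y x) (λ y → δ y (x + 1#))) ⟩
    ∑ (λ y → δ y x) ℤ.+ ∑ (λ y → δ y (x + 1#)) ℤ.+ ∑ (λ y → δ y (x - 1#))
      ≡⟨ cong₂ ℤ._+_ (cong₂ ℤ._+_ (∑-δ x) (∑-δ (x + 1#))) (∑-δ (x - 1#)) ⟩
    + 3                                                                ∎
    where
    difference : ∀ y → L y ≈ L x → (y - x) * ((y - (x + 1#)) * (y - (x - 1#))) ≈ 0#
    difference y eq = R.begin
      (y - x) * ((y - (x + 1#)) * (y - (x - 1#)))
        R.≈⟨ solve 2 (λ x y → (y :- x) :* ((y :- (x :+ con 1₃)) :* (y :- (x :- con 1₃)))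
               := y :* y :* y :- y :- (x :* x :* x :- x)) refl x y ⟩
      L y - L x                                      R.≈⟨ +-congʳ eq ⟩
      L x - L x                                      R.≈⟨ -‿inverseʳ _ ⟩
      0#                                             R.∎
    three-roots : ∀ y → δ (L y) (L x) ≡ δ y x ℤ.+ δ y (x + 1#) ℤ.+ δ y (x - 1#)
    three-roots y with y ≟ x | y ≟ x + 1# | y ≟ x - 1#
    ... | yes y≈x | yes y≈x+1 | _ = contradiction
      (trans (solve 1 (λ x → con 1₃ := x :+ con 1₃ :- x) refl x)
        (trans (+-congʳ (trans (sym y≈x+1) y≈x)) (-‿inverseʳ x))) 1≉0
    ... | yes y≈x | no _ | yes y≈x-1 = contradiction
      (trans (solve 1 (λ x → con 1₃ := x :- (x :- con 1₃)) refl x)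
        (trans (+-congˡ (-‿cong (trans (sym y≈x-1) y≈x))) (-‿inverseʳ x))) 1≉0
    ... | yes y≈x | no _ | no _ = δ-yes (L-cong y≈x)
    ... | no _ | yes y≈x+1 | yes y≈x-1 = contradiction
      (trans (solve 1 (λ x → con 1₃ := x :- con 1₃ :- (x :+ con 1₃)) refl x)
        (trans (+-congʳ (trans (sym y≈x-1) y≈x+1)) (-‿inverseʳ _))) 1≉0
    ... | no _ | yes y≈x+1 | no _ = δ-yes (trans (L-cong y≈x+1)
      (solve 1 (λ x → (x :+ con 1₃) :* (x :+ con 1₃) :* (x :+ con 1₃) :- (x :+ con 1₃) := x :* x :* x :- x) refl x))
    ... | no _ | no _ | yes y≈x-1 = δ-yes (trans (L-cong y≈x-1)
      (solve 1 (λ x → (x :- con 1₃) :* (x :- con 1₃) :* (x :- con 1₃) :- (x :- con 1₃) := x :* x :* x :- x) refl x))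
    ... | no y≉x | no y≉x+1 | no y≉x-1 = δ-no λ eq →
      *-≉0 (y≉x ∘ x-y≈0⇒x≈y) (*-≉0 (y≉x+1 ∘ x-y≈0⇒x≈y) (y≉x-1 ∘ x-y≈0⇒x≈y)) (difference y eq)

  S : Carrier → ℤ
  S w = ∑ λ x → χ (L x + w)

  -- Exchanging sums leaves the orthogonality relation for each pair `x`, `y`. For fixed `x` exactly
  -- three `y` have `L y ≈ L x`, so each `x` contributes `3 q - q`.
  S-second-moment : ∑ (λ w → S w ℤ.* S w) ≡ + 2 ℤ.* (+ q ℤ.* + q)
  S-second-moment = begin
    ∑ (λ w → S w ℤ.* S w)
      ≡⟨ ∑-cong (λ w → ≡.trans (≡.sym (∑-*ʳ (S w) λ x → χ (L x + w)))
           (∑-cong λ x → ≡.sym (∑-*ˡ (χ (L x + w)) λ y → χ (L y + w)))) ⟩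
    ∑ (λ w → ∑ λ x → ∑ λ y → χ (L x + w) ℤ.* χ (L y + w))
      ≡⟨ ∑-swap (λ w x → ∑ λ y → χ (L x + w) ℤ.* χ (L y + w)) ⟩
    ∑ (λ x → ∑ λ w → ∑ λ y → χ (L x + w) ℤ.* χ (L y + w))
      ≡⟨ ∑-cong (λ x → ≡.trans (∑-swap λ w y → χ (L x + w) ℤ.* χ (L y + w)) (∑-cong λ y →
           ≡.trans (χ-orthogonality (L x) (L y)) (cong (λ e → + q ℤ.* e ℤ.- 1ℤ) (δ-sym (L x) (L y))))) ⟩
    ∑ (λ x → ∑ λ y → + q ℤ.* δ (L y) (L x) ℤ.- 1ℤ)
      ≡⟨ ∑-cong (λ x → ≡.trans (∑-- (λ y → + q ℤ.* δ (L y) (L x)) (λ _ → 1ℤ)) (cong₂ ℤ._-_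
           (≡.trans (∑-*ˡ (+ q) λ y → δ (L y) (L x)) (cong (ℤ._*_ (+ q)) (L-fibre x))) (∑-const 1ℤ))) ⟩
    ∑ (λ x → + q ℤ.* + 3 ℤ.- + q ℤ.* 1ℤ)
      ≡⟨ ∑-const (+ q ℤ.* + 3 ℤ.- + q ℤ.* 1ℤ) ⟩
    + q ℤ.* (+ q ℤ.* + 3 ℤ.- + q ℤ.* 1ℤ)
      ≡⟨ solveℤ 1 (λ q → q ⊗ (q ⊗ κ (+ 3) ⊖ q ⊗ κ 1ℤ) ⊜ κ (+ 2) ⊗ (q ⊗ q)) ≡.refl (+ q) ⟩
    + 2 ℤ.* (+ q ℤ.* + q) ∎

-- The sum `S₀` modulo 8

module QuadraticCharacterModulo8 {c ℓ₁ ℓ₂} (K : HeytingField c ℓ₁ ℓ₂) {q}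
  (card : HasCardinality (HeytingField.setoid K) q)
  (3≈0 : HasCharacteristic3 (HeytingCommutativeRing.commutativeRing (HeytingField.heytingCommutativeRing K)))
  (8∣q-1 : + 8 ∣ᶻ + q ℤ.- 1ℤ) where
  open HeytingCommutativeRing (HeytingField.heytingCommutativeRing K) using (commutativeRing)
  open CommutativeRing commutativeRing hiding (zero)
  open FiniteField K card
  open FiniteIntegerSum setoid card
  open Characteristic3 commutativeRing 3≈0
  open SquareCounting K card 3≈0
  open ArtinSchreierSum K card 3≈0
  open import Algebra.Properties.Ring ring using (-0#≈0#)
  private module R = SetoidReasoning setoid
  open ≡.≡-Reasoning

  1+u² : Carrier → Carrier
  1+u² u = u * u + 1#

  1+u²-cong : ∀ {u v} → u ≈ v → 1+u² u ≈ 1+u² v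
  1+u²-cong u≈v = +-congʳ (*-cong u≈v u≈v)

  1+u²-even : ∀ u → 1+u² (- u) ≈ 1+u² u
  1+u²-even = solve 1 (λ u → :- u :* :- u :+ con 1₃ := u :* u :+ con 1₃) refl

  N-1+0² : N (1+u² 0#) ≡ + 2
  N-1+0² = ≡.trans (N-cong (solve 0 (con 0₃ :* con 0₃ :+ con 1₃ := con 1₃ :* con 1₃) refl)) (N-square 1≉0)

  ∑-N-1+u² : ∑ (N ∘ 1+u²) ≡ + q ℤ.- 1ℤ
  ∑-N-1+u² = begin
    ∑ (N ∘ 1+u²)                             ≡⟨ conic-count 1# ⟩
    + q ℤ.- 1ℤ ℤ.+ + q ℤ.* δ 1# 0#           ≡⟨ cong (λ e → + q ℤ.- 1ℤ ℤ.+ + q ℤ.* e) (δ-no 1≉0) ⟩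
    + q ℤ.- 1ℤ ℤ.+ + q ℤ.* 0ℤ
      ≡⟨ solveℤ 1 (λ q → q ⊖ κ 1ℤ ⊕ q ⊗ κ 0ℤ ⊜ q ⊖ κ 1ℤ) ≡.refl (+ q) ⟩
    + q ℤ.- 1ℤ                               ∎

  -- Negation fixes only zero, so the nonzero arguments come in pairs of equal value and the common
  -- divisor doubles.
  ∑-even-∣ : ∀ {f k} → Congruent f → (∀ u → f (- u) ≡ f u) → (∀ u → ¬ u ≈ 0# → k ∣ᶻ f u) → + 2 ℤ.* k ∣ᶻ ∑ f ℤ.- f 0#
  ∑-even-∣ = ∑-involution-∣ -_ -‿cong (solve 1 (λ u → :- (:- u) := u) refl) (λ u → s≈-s⇒s≈0 ∘ sym)
    (solve 0 (:- con 0₃ := con 0₃) refl)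

  -- Otherwise N (1 + u²) would always be even, and its sum q - 1 would be
  -- congruent to N 1 = 2 modulo 4.
  -1-square : Square (- 1#)
  -1-square with square? (- 1#)
  ... | yes sq = sq
  ... | no ¬sq = contradiction 4∣2 (from-no (+ 4 ∣ᶻ? + 2))
    where
    2∣ : ∀ u → ¬ u ≈ 0# → + 2 ∣ᶻ N (1+u² u)
    2∣ u _ = 2∣N λ 1+u²≈0 → ¬sq (u , (R.begin
      u * u              R.≈⟨ solve 1 (λ u → u :* u := u :* u :+ con 1₃ :- con 1₃) refl u ⟩
      1+u² u - 1#        R.≈⟨ +-congʳ 1+u²≈0 ⟩
      0# - 1#            R.≈⟨ +-identityˡ _ ⟩
      - 1#               R.∎))

    4∣q-3 : + 4 ∣ᶻ + q ℤ.- 1ℤ ℤ.- + 2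
    4∣q-3 = ≡.subst (+ 4 ∣ᶻ_) (cong₂ ℤ._-_ ∑-N-1+u² N-1+0²)
      (∑-even-∣ {N ∘ 1+u²} (N-cong ∘ 1+u²-cong) (N-cong ∘ 1+u²-even) 2∣)

    4∣2 : + 4 ∣ᶻ + 2
    4∣2 = ≡.subst (+ 4 ∣ᶻ_) (solveℤ 1 (λ p → p ⊖ (p ⊖ κ (+ 2)) ⊜ κ (+ 2)) ≡.refl (+ q ℤ.- 1ℤ))
      (∣m∣n⇒∣m-n (∣-trans (divides (+ 2) ≡.refl) 8∣q-1) 4∣q-3)

  N-neg : ∀ w → N (- w) ≡ N w
  N-neg w with i , i²≈-1 ← -1-square = ≡.trans
    (N-cong (trans (solve 1 (λ w → :- w := :- con 1₃ :* w) refl w) (*-congʳ (sym i²≈-1))))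
    (N-scale i≉0 w)
    where
    i≉0 : ¬ i ≈ 0#
    i≉0 i≈0 = 1≉0 (R.begin
      1#             R.≈⟨ solve 0 (con 1₃ := :- (:- con 1₃)) refl ⟩
      - (- 1#)       R.≈⟨ -‿cong i²≈-1 ⟨
      - (i * i)      R.≈⟨ -‿cong (trans (*-congʳ i≈0) (zeroˡ i)) ⟩
      - 0#           R.≈⟨ -0#≈0# ⟩
      0#             R.∎)

  S₀ : ℤ
  S₀ = ∑ (χ ∘ L)

  -- For `x ≠ 0` the equation `(x + u) x = 1` gives `u = x⁻¹ - x`, and multiplying by the square
  -- `x²` turns this into `- L x`; the sign is harmless because `- 1#` is a square. The column at
  -- `x = 0` is empty, in agreement with `χ (L 0#) = 0`.
  S₀-conic : ∑ (λ u → χ u ℤ.* N (1+u² u)) ≡ S₀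
  S₀-conic = ≡.trans (∑-N-conic χ 1#) (∑-cong column)
    where
    column : ∀ x → ∑ (λ u → χ u ℤ.* δ ((x + u) * x) 1#) ≡ χ (L x)
    column x with x ≟ 0#
    ... | yes x≈0 = begin
      ∑ (λ u → χ u ℤ.* δ ((x + u) * x) 1#)
        ≡⟨ ∑-cong (λ u → ≡.trans (cong (χ u ℤ.*_) (δ-no λ eq →
             1≉0 (trans (sym eq) (trans (*-congˡ x≈0) (zeroʳ (x + u)))))) (ℤₚ.*-zeroʳ (χ u))) ⟩
      ∑ (λ u → 0ℤ)                             ≡⟨ ≡.trans (∑-const 0ℤ) (ℤₚ.*-zeroʳ (+ q)) ⟩
      1ℤ ℤ.- 1ℤ                                ≡⟨ cong (ℤ._- 1ℤ) (≡.trans (N-cong L≈0) N-0) ⟨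
      χ (L x)                                  ∎
      where
      L≈0 : L x ≈ 0#
      L≈0 = trans (L-cong x≈0) (solve 0 (con 0₃ :* con 0₃ :* con 0₃ :- con 0₃ := con 0₃) refl)
    ... | no x≉0 with x⁻¹ , xx⁻¹≈1 ← ≉0⇒inverse x≉0 = begin
      ∑ (λ u → χ u ℤ.* δ ((x + u) * x) 1#)     ≡⟨ ∑-hyperbola χ-cong x≉0 xx⁻¹≈1 1# ⟩
      χ (1# * x⁻¹ - x)                         ≡⟨ cong (ℤ._- 1ℤ) (N-scale x≉0 _) ⟨
      χ (x * x * (1# * x⁻¹ - x))               ≡⟨ χ-cong (R.begin
        x * x * (1# * x⁻¹ - x)
          R.≈⟨ solve 2 (λ x y → x :* x :* (con 1₃ :* y :- x) := x :* (x :* y) :- x :* x :* x) refl x x⁻¹ ⟩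
        x * (x * x⁻¹) - x * x * x                R.≈⟨ +-congʳ (*-congˡ xx⁻¹≈1) ⟩
        x * 1# - x * x * x
          R.≈⟨ solve 1 (λ x → x :* con 1₃ :- x :* x :* x := :- (x :* x :* x :- x)) refl x ⟩
        - L x                                    R.∎) ⟩
      χ (- L x)                                ≡⟨ cong (ℤ._- 1ℤ) (N-neg (L x)) ⟩
      χ (L x)                                  ∎

  module _ {γ} (γ-nonsquare : ¬ Square γ) where

    γ≉0 : ¬ γ ≈ 0#
    γ≉0 γ≈0 = γ-nonsquare (0# , trans (zeroˡ 0#) (sym γ≈0))

    N-γ : ∀ w → N (γ * w) ≡ 1ℤ ℤ.- χ w
    N-γ w = begin
      N (γ * w)                        ≡⟨ solveℤ 2 (λ a b → a ⊜ a ⊕ b ⊖ b) ≡.refl (N (γ * w)) (N w) ⟩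
      N (γ * w) ℤ.+ N w ℤ.- N w        ≡⟨ cong (ℤ._- N w) (N-twist γ-nonsquare w) ⟩
      + 2 ℤ.- N w
        ≡⟨ solveℤ 1 (λ n → κ (+ 2) ⊖ n ⊜ κ 1ℤ ⊖ (n ⊖ κ 1ℤ)) ≡.refl (N w) ⟩
      1ℤ ℤ.- χ w                       ∎

    -- The number of points of γ u = s², u² + 1 = t² above u.
    H : Carrier → ℤ
    H u = N (γ * u) ℤ.* N (1+u² u)

    ∑-H : ∑ H ≡ + q ℤ.- 1ℤ ℤ.- S₀
    ∑-H = begin
      ∑ H
        ≡⟨ ∑-cong (λ u → ≡.trans (cong (ℤ._* N (1+u² u)) (N-γ u))
             (solveℤ 2 (λ x n → (κ 1ℤ ⊖ x) ⊗ n ⊜ n ⊖ x ⊗ n) ≡.refl (χ u) (N (1+u² u)))) ⟩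
      ∑ (λ u → N (1+u² u) ℤ.- χ u ℤ.* N (1+u² u))                  ≡⟨ ∑-- (N ∘ 1+u²) (λ u → χ u ℤ.* N (1+u² u)) ⟩
      ∑ (N ∘ 1+u²) ℤ.- ∑ (λ u → χ u ℤ.* N (1+u² u))                ≡⟨ cong₂ ℤ._-_ ∑-N-1+u² S₀-conic ⟩
      + q ℤ.- 1ℤ ℤ.- S₀                                            ∎

    -- Each factor of `H u` is even when its argument is nonzero. If `1 + u² = 0`, the second factor
    -- is odd, but then `u` is a square, so `γ * u` is not and the first factor vanishes.
    4∣H : ∀ u → ¬ u ≈ 0# → + 4 ∣ᶻ H u
    4∣H u u≉0 with 1+u² u ≟ 0#
    ... | no 1+u²≉0 with divides a eqa ← 2∣N (*-≉0 γ≉0 u≉0) | divides b eqb ← 2∣N 1+u²≉0 =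
      divides (a ℤ.* b) (≡.trans (cong₂ ℤ._*_ eqa eqb)
        (solveℤ 2 (λ a b → a ⊗ κ (+ 2) ⊗ (b ⊗ κ (+ 2)) ⊜ a ⊗ b ⊗ κ (+ 4)) ≡.refl a b))
    ... | yes 1+u²≈0 = divides 0ℤ (cong (ℤ._* N (1+u² u)) (≡.trans (N-γ u) (cong (λ n → 1ℤ ℤ.- (n ℤ.- 1ℤ)) N-u≡2)))
      where
      -- When `u² = -1`, characteristic 3 gives `(1 + u)² = 2 u = - u`, and multiplying by `u² = -1`
      -- gives `u`.
      s : Carrier
      s = u * (1# + u)

      s²≈u : s * s ≈ u
      s²≈u = R.begin
        s * s
          R.≈⟨ solve 1 (λ u → u :* (con 1₃ :+ u) :* (u :* (con 1₃ :+ u))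
                      := u :+ (u :* u :+ con 1₃) :* (u :* u :- u)) refl u ⟩
        u + 1+u² u * (u * u - u)           R.≈⟨ +-congˡ (trans (*-congʳ 1+u²≈0) (zeroˡ _)) ⟩
        u + 0#                             R.≈⟨ +-identityʳ u ⟩
        u                                  R.∎

      N-u≡2 : N u ≡ + 2
      N-u≡2 = ≡.trans (N-cong (sym s²≈u)) (N-square λ s≈0 → u≉0 (trans (sym s²≈u) (trans (*-congʳ s≈0) (zeroˡ s))))

    -- `H` is even because `- 1#` is a square, so its multiples of 4 away from zero pair up to
    -- multiples of 8. The remaining 2 is `H 0#`, from the single root of 0 and the two roots of 1.
    S₀-mod-8 : + 8 ∣ᶻ + q ℤ.- 1ℤ ℤ.- S₀ ℤ.- + 2
    S₀-mod-8 = ≡.subst (+ 8 ∣ᶻ_) (cong₂ ℤ._-_ ∑-H H-0) (∑-even-∣ {H} H-cong H-even 4∣H)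
      where
      H-cong : Congruent H
      H-cong u≈v = cong₂ ℤ._*_ (N-cong (*-congˡ u≈v)) (N-cong (1+u²-cong u≈v))

      H-even : ∀ u → H (- u) ≡ H u
      H-even u = cong₂ ℤ._*_ (≡.trans (N-cong (solve 2 (λ γ u → γ :* :- u := :- (γ :* u)) refl γ u)) (N-neg (γ * u)))
        (N-cong (1+u²-even u))

      H-0 : H 0# ≡ + 2
      H-0 = cong₂ ℤ._*_ (≡.trans (N-cong (zeroʳ γ)) N-0) N-1+0²

-- Selecting an integer square root by its residue modulo 4

-- Meant for `r = S₀`, `s = σ` and `p = q - 1`. The two multiples of 8 differ by `2 (1 - s)`.
4∣1-s : ∀ r s p → r ≡ ℤ.- (+ 2 ℤ.* s) → + 8 ∣ᶻ p → + 8 ∣ᶻ p ℤ.- r ℤ.- + 2 → + 4 ∣ᶻ 1ℤ ℤ.- s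
4∣1-s r s p ≡.refl 8∣p 8∣p+2s-2 = *-cancelˡ-∣ (+ 2) {+ 4} (≡.subst (+ 8 ∣ᶻ_)
  (solveℤ 2 (λ p s → p ⊖ (p ⊖ (⊝ (κ (+ 2) ⊗ s)) ⊖ κ (+ 2)) ⊜ κ (+ 2) ⊗ (κ 1ℤ ⊖ s)) ≡.refl p s)
  (∣m∣n⇒∣m-n 8∣p 8∣p+2s-2))

-- Equal squares leave `s = p` or `s = - p`. In the second case `(1 - s) - (p - 1) = 2` would be
-- divisible by 4.
square-root-unique : ∀ s p {n} → s ℤ.* s ≡ n → p ℤ.* p ≡ n → + 4 ∣ᶻ 1ℤ ℤ.- s → + 4 ∣ᶻ p ℤ.- 1ℤ → s ≡ p
square-root-unique s p {n} s² p² 4∣1-s 4∣p-1 with ℤₚ.i*j≡0⇒i≡0∨j≡0 (s ℤ.- p) (begin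
    (s ℤ.- p) ℤ.* (s ℤ.+ p)
      ≡⟨ solveℤ 2 (λ s p → (s ⊖ p) ⊗ (s ⊕ p) ⊜ s ⊗ s ⊖ p ⊗ p) ≡.refl s p ⟩
    s ℤ.* s ℤ.- p ℤ.* p        ≡⟨ cong₂ ℤ._-_ s² p² ⟩
    n ℤ.- n                    ≡⟨ ℤₚ.+-inverseʳ n ⟩
    0ℤ                         ∎)
  where open ≡.≡-Reasoning
... | inj₁ s-p≡0 = ℤₚ.i-j≡0⇒i≡j s p s-p≡0
... | inj₂ s+p≡0 = contradiction (≡.subst (+ 4 ∣ᶻ_) (begin
    1ℤ ℤ.- s ℤ.- (p ℤ.- 1ℤ)
      ≡⟨ solveℤ 2 (λ s p → κ 1ℤ ⊖ s ⊖ (p ⊖ κ 1ℤ) ⊜ κ (+ 2) ⊖ (s ⊕ p)) ≡.refl s p ⟩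
    + 2 ℤ.- (s ℤ.+ p)          ≡⟨ cong (ℤ._-_ (+ 2)) s+p≡0 ⟩
    + 2                        ∎) (∣m∣n⇒∣m-n 4∣1-s 4∣p-1)) (from-no (+ 4 ∣ᶻ? + 2))
  where open ≡.≡-Reasoning

-- Trace classes and the determination of `σ`

module TraceClasses {c ℓ₁ ℓ₂} (K : HeytingField c ℓ₁ ℓ₂) {q} (card : HasCardinality (HeytingField.setoid K) q)
  (3≈0 : HasCharacteristic3 (HeytingCommutativeRing.commutativeRing (HeytingField.heytingCommutativeRing K)))
  (8∣q-1 : + 8 ∣ᶻ + q ℤ.- 1ℤ) (k : ℕ) (q≡3^1+k : q ≡ 3 ℕ.^ suc k) where
  open HeytingCommutativeRing (HeytingField.heytingCommutativeRing K) using (commutativeRing)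
  open CommutativeRing commutativeRing hiding (zero)
  open FiniteField K card
  open FiniteIntegerSum setoid card
  open Characteristic3 commutativeRing 3≈0
  open SquareCounting K card 3≈0
  open ArtinSchreierSum K card 3≈0
  open QuadraticCharacterModulo8 K card 3≈0 8∣q-1
  open import Algebra.Definitions.RawSemiring (Semiring.rawSemiring semiring) using (_^_)
  open import Algebra.Properties.Semiring.Exp semiring using (^-congʳ)
  open import Algebra.Properties.Ring ring using (-0#≈0#)
  private module R = SetoidReasoning setoid
  open ≡.≡-Reasoning

  T : Carrier → Carrier
  T = trace (suc k)

  T-cong : ∀ {x y} → x ≈ y → T x ≈ T y
  T-cong = trace-cong (suc k)

  -- Since `x ^ q ≈ x`, Frobenius merely permutes the conjugates cyclically. Hence `T` takes its
  -- values among the roots of `t³ = t` and kills the image of `L`.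
  T-cube-arg : ∀ x → T (x ^ 3) ≈ T x
  T-cube-arg x = R.begin
    T (x ^ 3)                            R.≈⟨ solve 2 (λ x t → t := x :+ t :- x) refl x (T (x ^ 3)) ⟩
    x + T (x ^ 3) - x                    R.≈⟨ +-congʳ (trace-telescope (suc k) x) ⟩
    T x + x ^ (3 ℕ.^ suc k) - x          R.≈⟨ +-congʳ (+-congˡ (trans (^-congʳ x (≡.sym q≡3^1+k)) (fermat x))) ⟩
    T x + x - x                          R.≈⟨ solve 2 (λ x t → t :+ x :- x := t) refl x (T x) ⟩
    T x                                  R.∎

  T-L : ∀ x → T (L x) ≈ 0#
  T-L x = R.begin
    T (L x)               R.≈⟨ T-cong (solve 1 (λ x → x :* x :* x :- x := x :^ 3 :+ :- x) refl x) ⟩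
    T (x ^ 3 + - x)       R.≈⟨ trace-+ (suc k) (x ^ 3) (- x) ⟩
    T (x ^ 3) + T (- x)   R.≈⟨ +-cong (T-cube-arg x) (trace-neg (suc k) x) ⟩
    T x - T x             R.≈⟨ -‿inverseʳ (T x) ⟩
    0#                    R.∎

  data InPrimeField (t : Carrier) : Set ℓ₁ where
    is0  : t ≈ 0# → InPrimeField t
    is1  : t ≈ 1# → InPrimeField t
    is-1 : t ≈ - 1# → InPrimeField t

  cube-fixed : ∀ {t} → t ^ 3 ≈ t → InPrimeField t
  cube-fixed {t} t³≈t with x*y≈0⇒x≈0∨y≈0 factored
    where
    factored : t * ((t - 1#) * (t + 1#)) ≈ 0#
    factored = R.begin
      t * ((t - 1#) * (t + 1#))   R.≈⟨ solve 1 (λ t → t :* ((t :- con 1₃) :* (t :+ con 1₃)) := t :^ 3 :- t) refl t ⟩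
      t ^ 3 - t                   R.≈⟨ +-congʳ t³≈t ⟩
      t - t                       R.≈⟨ -‿inverseʳ t ⟩
      0#                          R.∎
  ... | inj₁ t≈0 = is0 t≈0
  ... | inj₂ eq with x*y≈0⇒x≈0∨y≈0 eq
  ...   | inj₁ t-1≈0 = is1 (x-y≈0⇒x≈y t-1≈0)
  ...   | inj₂ t+1≈0 = is-1 (x-y≈0⇒x≈y (trans (solve 1 (λ t → t :- :- con 1₃ := t :+ con 1₃) refl t) t+1≈0))

  T-value : ∀ x → InPrimeField (T x)
  T-value x = cube-fixed (trans (sym (trace-cube (suc k) x)) (T-cube-arg x))

  1≉-1 : ¬ 1# ≈ - 1#
  1≉-1 = 1≉0 ∘ s≈-s⇒s≈0

  -1≉0 : ¬ - 1# ≈ 0#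
  -1≉0 -1≈0 = 1≉0 (trans (solve 0 (con 1₃ := :- (:- con 1₃)) refl) (trans (-‿cong -1≈0) -0#≈0#))

  -- `T` is a monic polynomial function of degree `3 ^ k < q`, so it cannot vanish at `3 ^ k + 1`
  -- distinct elements.
  T-nonzero : ∃[ x ] ¬ T x ≈ 0#
  T-nonzero with decide∃ (λ x≈y Tx≉0 Ty≈0 → Tx≉0 (trans (T-cong x≈y) Ty≈0)) (λ x → ¬? (T x ≟ 0#))
  ... | yes found = found
  ... | no ¬found = contradiction (Polynomial-roots x*y≈0⇒x≈0∨y≈0 (3 ℕ.^ k) (Polynomial-trace k) root
                                     (Fin.inject≤-injective 3^k<q 3^k<q _ _ ∘ Finite.from-injective setoid card)
                                      T-root) 1≉0
    where
    3^k<q : 3 ℕ.^ k < q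
    3^k<q = ≡.subst (3 ℕ.^ k <_) (≡.sym q≡3^1+k) (ℕₚ.^-monoʳ-< 3 (s≤s (s≤s z≤n)) (ℕₚ.n<1+n k))
    root : Fin (suc (3 ℕ.^ k)) → Carrier
    root i = from (inject≤ i 3^k<q)
    T-root : ∀ i → T (root i) ≈ 0#
    T-root i with T (root i) ≟ 0#
    ... | yes eq = eq
    ... | no neq = contradiction (root i , neq) ¬found

  T-one : ∃[ θ ] T θ ≈ 1#
  T-one = normalise T-nonzero
    where
    normalised : ∀ {x} → ¬ T x ≈ 0# → InPrimeField (T x) → ∃[ θ ] T θ ≈ 1#
    normalised     Tx≉0 (is0 Tx≈0)   = contradiction Tx≈0 Tx≉0
    normalised {x} Tx≉0 (is1 Tx≈1)   = x , Tx≈1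
    normalised {x} Tx≉0 (is-1 Tx≈-1) = - x , trans (trace-neg (suc k) x)
      (trans (-‿cong Tx≈-1) (solve 0 (:- (:- con 1₃) := con 1₃) refl))

    normalise : ∃[ x ] ¬ T x ≈ 0# → ∃[ θ ] T θ ≈ 1#
    normalise (x , Tx≉0) = normalised Tx≉0 (T-value x)

  weigh : ∀ (h : Carrier → ℤ) {a b c a′ b′ c′} → a ≡ a′ → b ≡ b′ → c ≡ c′ →
          a ℤ.* h 0# ℤ.+ b ℤ.* h 1# ℤ.+ c ℤ.* h (- 1#) ≡ a′ ℤ.* h 0# ℤ.+ b′ ℤ.* h 1# ℤ.+ c′ ℤ.* h (- 1#)
  weigh h ≡.refl ≡.refl ≡.refl = ≡.refl

  split-by-value : ∀ {h} → Congruent h → ∀ {t} → InPrimeField t →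
                   h t ≡ δ t 0# ℤ.* h 0# ℤ.+ δ t 1# ℤ.* h 1# ℤ.+ δ t (- 1#) ℤ.* h (- 1#)
  split-by-value {h} h-cong (is0 t≈0) = ≡.trans (h-cong t≈0) (≡.trans
    (solveℤ 3 (λ x y z → x ⊜ κ 1ℤ ⊗ x ⊕ κ 0ℤ ⊗ y ⊕ κ 0ℤ ⊗ z) ≡.refl (h 0#) (h 1#) (h (- 1#)))
    (≡.sym (weigh h (δ-yes t≈0) (δ-no λ t≈1 → 1≉0 (trans (sym t≈1) t≈0))
      (δ-no λ t≈-1 → -1≉0 (trans (sym t≈-1) t≈0)))))
  split-by-value {h} h-cong (is1 t≈1) = ≡.trans (h-cong t≈1) (≡.trans
    (solveℤ 3 (λ x y z → y ⊜ κ 0ℤ ⊗ x ⊕ κ 1ℤ ⊗ y ⊕ κ 0ℤ ⊗ z) ≡.refl (h 0#) (h 1#) (h (- 1#)))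
    (≡.sym (weigh h (δ-no λ t≈0 → 1≉0 (trans (sym t≈1) t≈0)) (δ-yes t≈1)
      (δ-no λ t≈-1 → 1≉-1 (trans (sym t≈1) t≈-1)))))
  split-by-value {h} h-cong (is-1 t≈-1) = ≡.trans (h-cong t≈-1) (≡.trans
    (solveℤ 3 (λ x y z → z ⊜ κ 0ℤ ⊗ x ⊕ κ 0ℤ ⊗ y ⊕ κ 1ℤ ⊗ z) ≡.refl (h 0#) (h 1#) (h (- 1#)))
    (≡.sym (weigh h (δ-no λ t≈0 → -1≉0 (trans (sym t≈-1) t≈0)) (δ-no λ t≈1 → 1≉-1 (trans (sym t≈1) t≈-1))
      (δ-yes t≈-1))))

  split-by-T : ∀ {h} → Congruent h → ∀ w →
               h (T w) ≡ δ (T w) 0# ℤ.* h 0# ℤ.+ δ (T w) 1# ℤ.* h 1# ℤ.+ δ (T w) (- 1#) ℤ.* h (- 1#)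
  split-by-T h-cong w = split-by-value h-cong (T-value w)

  ∑-split-by-T : ∀ {h} → Congruent h →
                 ∑ (h ∘ T) ≡ fibre T 0# ℤ.* h 0# ℤ.+ fibre T 1# ℤ.* h 1# ℤ.+ fibre T (- 1#) ℤ.* h (- 1#)
  ∑-split-by-T {h} h-cong = begin
    ∑ (h ∘ T)                                                        ≡⟨ ∑-cong (split-by-T h-cong) ⟩
    ∑ (λ w → part 0# w ℤ.+ part 1# w ℤ.+ part (- 1#) w)
      ≡⟨ ∑-+ (λ w → part 0# w ℤ.+ part 1# w) (part (- 1#)) ⟩
    ∑ (λ w → part 0# w ℤ.+ part 1# w) ℤ.+ ∑ (part (- 1#))
      ≡⟨ cong (ℤ._+ ∑ (part (- 1#))) (∑-+ (part 0#) (part 1#)) ⟩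
    ∑ (part 0#) ℤ.+ ∑ (part 1#) ℤ.+ ∑ (part (- 1#))
      ≡⟨ cong₂ ℤ._+_ (cong₂ ℤ._+_ (∑-part 0#) (∑-part 1#)) (∑-part (- 1#)) ⟩
    fibre T 0# ℤ.* h 0# ℤ.+ fibre T 1# ℤ.* h 1# ℤ.+ fibre T (- 1#) ℤ.* h (- 1#) ∎
    where
    part : Carrier → Carrier → ℤ
    part t w = δ (T w) t ℤ.* h t
    ∑-part : ∀ t → ∑ (part t) ≡ fibre T t ℤ.* h t
    ∑-part t = ∑-*ʳ (h t) (λ w → δ (T w) t)

  δ-T-shift : ∀ v w t → δ (T (w + v)) (t + T v) ≡ δ (T w) t
  δ-T-shift v w t = δ-⇔
    (λ eq → R.begin
      T w                    R.≈⟨ solve 2 (λ s v → s := s :+ v :- v) refl (T w) (T v) ⟩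
      T w + T v - T v        R.≈⟨ +-congʳ (trans (sym (trace-+ (suc k) w v)) eq) ⟩
      t + T v - T v          R.≈⟨ solve 2 (λ s v → s :+ v :- v := s) refl t (T v) ⟩
      t                      R.∎)
    (λ eq → trans (trace-+ (suc k) w v) (+-congʳ eq))

  ∑-shift : ∀ {f} → Congruent f → ∀ v → ∑ f ≡ ∑ (λ w → f (w + v))
  ∑-shift f-cong v = ∑-reindex f-cong (_+ v) (_- v) +-congʳ +-congʳ
    (λ x → solve 2 (λ x v → x :- v :+ v := x) refl x v) (λ x → solve 2 (λ x v → x :+ v :- v := x) refl x v)

  fibre-T-shift : ∀ v t → fibre T (t + T v) ≡ fibre T t
  fibre-T-shift v t =
    ≡.trans (∑-shift {λ w → δ (T w) (t + T v)} (λ x≈y → δ-cong (T-cong x≈y) refl) v)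
      (∑-cong λ w → δ-T-shift v w t)

  fibre-T-1 : fibre T 1# ≡ fibre T 0#
  fibre-T-1 = let (θ , Tθ≈1) = T-one in
    ≡.trans (fibre-cong T (trans (sym (+-identityˡ 1#)) (+-congˡ (sym Tθ≈1)))) (fibre-T-shift θ 0#)

  fibre-T--1 : fibre T (- 1#) ≡ fibre T 0#
  fibre-T--1 = let (θ , Tθ≈1) = T-one in
    ≡.trans (≡.sym (fibre-T-shift θ (- 1#))) (fibre-cong T (trans (+-congˡ Tθ≈1) (-‿inverseˡ 1#)))

  3*fibre-T : + 3 ℤ.* fibre T 0# ≡ + q
  3*fibre-T = begin
    + 3 ℤ.* fibre T 0#
      ≡⟨ solveℤ 1 (λ n → κ (+ 3) ⊗ n ⊜ n ⊗ κ 1ℤ ⊕ n ⊗ κ 1ℤ ⊕ n ⊗ κ 1ℤ) ≡.refl (fibre T 0#) ⟩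
    fibre T 0# ℤ.* 1ℤ ℤ.+ fibre T 0# ℤ.* 1ℤ ℤ.+ fibre T 0# ℤ.* 1ℤ
      ≡⟨ cong₂ (λ m n → fibre T 0# ℤ.* 1ℤ ℤ.+ m ℤ.* 1ℤ ℤ.+ n ℤ.* 1ℤ) fibre-T-1 fibre-T--1 ⟨
    fibre T 0# ℤ.* 1ℤ ℤ.+ fibre T 1# ℤ.* 1ℤ ℤ.+ fibre T (- 1#) ℤ.* 1ℤ
      ≡⟨ ∑-split-by-T {λ _ → 1ℤ} (λ _ → ≡.refl) ⟨
    ∑ (λ _ → 1ℤ)
      ≡⟨ ≡.trans (∑-const 1ℤ) (ℤₚ.*-identityʳ (+ q)) ⟩
    + q ∎

  -- Additive Hilbert 90: the image of L lies in the kernel of T, and both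
  -- have q / 3 elements.
  fibre-L : ∀ w → fibre L w ≡ + 3 ℤ.* δ (T w) 0#
  fibre-L = ∑-mono-≤-rigid (fibre-cong L) (λ x≈y → cong (+ 3 ℤ.*_) (δ-cong (T-cong x≈y) refl)) bound
    (≡.trans (∑-fibre-1 L) (≡.sym (≡.trans (∑-*ˡ (+ 3) (λ w → δ (T w) 0#)) 3*fibre-T)))
    where
    empty : ∀ {w} → ¬ (∃[ x ] L x ≈ w) → fibre L w ≡ 0ℤ
    empty ∄x = ≡.trans (∑-cong λ x → δ-no λ eq → ∄x (x , eq)) (≡.trans (∑-const 0ℤ) (ℤₚ.*-zeroʳ (+ q)))

    bound : ∀ w → fibre L w ℤ.≤ + 3 ℤ.* δ (T w) 0#
    bound w with T w ≟ 0# | decide∃ {P = λ x → L x ≈ w} (λ x≈y → trans (L-cong (sym x≈y))) (λ x → L x ≟ w)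
    ... | yes _   | yes (x , Lx≈w) = ℤₚ.≤-reflexive (≡.trans (fibre-cong L (sym Lx≈w)) (L-fibre x))
    ... | yes _   | no ∄x          = ≡.subst (ℤ._≤ + 3) (≡.sym (empty ∄x)) (ℤ.+≤+ z≤n)
    ... | no Tw≉0 | _              = ℤₚ.≤-reflexive (empty λ (x , Lx≈w) → Tw≉0 (trans (T-cong (sym Lx≈w)) (T-L x)))

  A : Carrier → ℤ
  A t = ∑ λ w → δ (T w) t ℤ.* χ w

  A-cong : Congruent A
  A-cong s≈t = ∑-cong λ w → cong (ℤ._* χ w) (δ-cong (refl {T w}) s≈t)

  -- Grouping the sum by the value of `L` runs three times through the kernel of `T`, and
  -- translation by `v` carries the kernel onto the class of trace `T v`.
  S≡3A : ∀ v → S v ≡ + 3 ℤ.* A (T v)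
  S≡3A v = begin
    ∑ (λ x → χ (L x + v))                             ≡⟨ ∑-fibre L {λ w → χ (w + v)} (χ-cong ∘ +-congʳ) ⟨
    ∑ (λ w → fibre L w ℤ.* χ (w + v))
      ≡⟨ ∑-cong (λ w → ≡.trans (cong (ℤ._* χ (w + v)) (fibre-L w)) (ℤₚ.*-assoc (+ 3) (δ (T w) 0#) (χ (w + v)))) ⟩
    ∑ (λ w → + 3 ℤ.* (δ (T w) 0# ℤ.* χ (w + v)))      ≡⟨ ∑-*ˡ (+ 3) (λ w → δ (T w) 0# ℤ.* χ (w + v)) ⟩
    + 3 ℤ.* ∑ (λ w → δ (T w) 0# ℤ.* χ (w + v))
      ≡⟨ cong (+ 3 ℤ.*_) (∑-cong λ w → cong (ℤ._* χ (w + v)) (≡.trans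
           (δ-cong refl (sym (+-identityˡ (T v)))) (δ-T-shift v w 0#))) ⟨
    + 3 ℤ.* ∑ (λ w → δ (T (w + v)) (T v) ℤ.* χ (w + v))
      ≡⟨ cong (+ 3 ℤ.*_) (∑-shift {λ w → δ (T w) (T v) ℤ.* χ w}
         (λ x≈y → cong₂ ℤ._*_ (δ-cong (T-cong x≈y) refl) (χ-cong x≈y)) v) ⟨
    + 3 ℤ.* A (T v)                                   ∎

  -- Negation exchanges the two trace classes and preserves `χ`, because `- 1#` is a square.
  A-neg : A (- 1#) ≡ A 1#
  A-neg = begin
    ∑ (λ w → δ (T w) (- 1#) ℤ.* χ w)
      ≡⟨ ∑-reindex {λ w → δ (T w) (- 1#) ℤ.* χ w} (λ x≈y → cong₂ ℤ._*_ (δ-cong (T-cong x≈y) refl) (χ-cong x≈y))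
           -_ -_ -‿cong -‿cong -‿involutive -‿involutive ⟩
    ∑ (λ w → δ (T (- w)) (- 1#) ℤ.* χ (- w))
      ≡⟨ ∑-cong (λ w → cong₂ ℤ._*_ (δ-⇔ (forth w) (back w)) (cong (ℤ._- 1ℤ) (N-neg w))) ⟩
    ∑ (λ w → δ (T w) 1# ℤ.* χ w)                 ∎
    where
    -‿involutive : ∀ x → - (- x) ≈ x
    -‿involutive = solve 1 (λ x → :- (:- x) := x) refl
    forth : ∀ w → T (- w) ≈ - 1# → T w ≈ 1#
    forth w eq = trans (sym (-‿involutive _)) (trans (-‿cong (trans (sym (trace-neg (suc k) w)) eq)) (-‿involutive _))
    back : ∀ w → T w ≈ 1# → T (- w) ≈ - 1#
    back w eq = trans (trace-neg (suc k) w) (-‿cong eq)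

  A-sum : A 0# ℤ.+ A 1# ℤ.+ A (- 1#) ≡ 0ℤ
  A-sum = begin
    A 0# ℤ.+ A 1# ℤ.+ A (- 1#)
      ≡⟨ ≡.trans (∑-+ (λ w → part 0# w ℤ.+ part 1# w) (part (- 1#)))
         (cong (ℤ._+ A (- 1#)) (∑-+ (part 0#) (part 1#))) ⟨
    ∑ (λ w → part 0# w ℤ.+ part 1# w ℤ.+ part (- 1#) w)  ≡⟨ ∑-cong (λ w → split-by-T {λ _ → χ w} (λ _ → ≡.refl) w) ⟨
    ∑ χ                                                  ≡⟨ ∑-- N (λ _ → 1ℤ) ⟩
    ∑ N ℤ.- ∑ (λ _ → 1ℤ)
      ≡⟨ cong₂ ℤ._-_ ∑-N (≡.trans (∑-const 1ℤ) (ℤₚ.*-identityʳ (+ q))) ⟩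
    + q ℤ.- + q                                          ≡⟨ ℤₚ.+-inverseʳ (+ q) ⟩
    0ℤ                                                   ∎
    where
    part : Carrier → Carrier → ℤ
    part t w = δ (T w) t ℤ.* χ w

  A-0 : A 0# ≡ ℤ.- (+ 2 ℤ.* A 1#)
  A-0 = begin
    A 0#
      ≡⟨ solveℤ 3 (λ x y z → x ⊜ x ⊕ y ⊕ z ⊖ (y ⊕ z)) ≡.refl (A 0#) (A 1#) (A (- 1#)) ⟩
    A 0# ℤ.+ A 1# ℤ.+ A (- 1#) ℤ.- (A 1# ℤ.+ A (- 1#))     ≡⟨ cong₂ (λ s t → s ℤ.- (A 1# ℤ.+ t)) A-sum A-neg ⟩
    0ℤ ℤ.- (A 1# ℤ.+ A 1#)
      ≡⟨ solveℤ 1 (λ a → κ 0ℤ ⊖ (a ⊕ a) ⊜ ⊝ (κ (+ 2) ⊗ a)) ≡.refl (A 1#) ⟩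
    ℤ.- (+ 2 ℤ.* A 1#)                                     ∎

  σ : ℤ
  σ = + 3 ℤ.* A 1#

  S-0 : ∀ {v} → T v ≈ 0# → S v ≡ ℤ.- (+ 2 ℤ.* σ)
  S-0 {v} Tv≈0 = ≡.trans (S≡3A v) (≡.trans (cong (+ 3 ℤ.*_) (≡.trans (A-cong Tv≈0) A-0))
    (solveℤ 1 (λ a → κ (+ 3) ⊗ (⊝ (κ (+ 2) ⊗ a)) ⊜ ⊝ (κ (+ 2) ⊗ (κ (+ 3) ⊗ a))) ≡.refl (A 1#)))

  S-±1 : ∀ {v} → T v ≈ 1# ⊎ T v ≈ - 1# → S v ≡ σ
  S-±1 {v} (inj₁ Tv≈1)  = ≡.trans (S≡3A v) (cong (+ 3 ℤ.*_) (A-cong Tv≈1))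
  S-±1 {v} (inj₂ Tv≈-1) = ≡.trans (S≡3A v) (cong (+ 3 ℤ.*_) (≡.trans (A-cong Tv≈-1) A-neg))

  -- Each trace class has `q / 3` elements, and `S²` is `4 σ²` on the kernel and `σ²` on each of the
  -- other two. The second moment is therefore `2 q σ²` as well as `2 q²`, and `2 q` cancels.
  σ² : σ ℤ.* σ ≡ + q
  σ² = ℤₚ.*-cancelˡ-≡ (+ 2 ℤ.* + q) (σ ℤ.* σ) (+ q) ⦃ 2q≢0 ⦄ (begin
    + 2 ℤ.* + q ℤ.* (σ ℤ.* σ)
      ≡⟨ cong (λ p → + 2 ℤ.* p ℤ.* (σ ℤ.* σ)) 3*fibre-T ⟨
    + 2 ℤ.* (+ 3 ℤ.* fibre T 0#) ℤ.* (σ ℤ.* σ)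
      ≡⟨ solveℤ 2 (λ n a → let a₀ = κ (+ 3) ⊗ (⊝ (κ (+ 2) ⊗ a)) ; s = κ (+ 3) ⊗ a in
                      κ (+ 2) ⊗ (κ (+ 3) ⊗ n) ⊗ (s ⊗ s)
                      ⊜ n ⊗ (a₀ ⊗ a₀) ⊕ n ⊗ (s ⊗ s) ⊕ n ⊗ (s ⊗ s)) ≡.refl (fibre T 0#) (A 1#) ⟩
    fibre T 0# ℤ.* B (ℤ.- (+ 2 ℤ.* A 1#)) ℤ.+ fibre T 0# ℤ.* B (A 1#) ℤ.+ fibre T 0# ℤ.* B (A 1#)
      ≡⟨ cong₂ ℤ._+_ (cong₂ ℤ._+_ (cong (λ a → fibre T 0# ℤ.* B a) A-0) (cong (ℤ._* B (A 1#)) fibre-T-1))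
         (cong₂ (λ n a → n ℤ.* B a) fibre-T--1 A-neg) ⟨
    fibre T 0# ℤ.* B (A 0#) ℤ.+ fibre T 1# ℤ.* B (A 1#) ℤ.+ fibre T (- 1#) ℤ.* B (A (- 1#))
      ≡⟨ ∑-split-by-T {B ∘ A} (cong B ∘ A-cong) ⟨
    ∑ (λ w → B (A (T w)))
      ≡⟨ ∑-cong (λ w → cong₂ ℤ._*_ (S≡3A w) (S≡3A w)) ⟨
    ∑ (λ w → S w ℤ.* S w)
      ≡⟨ S-second-moment ⟩
    + 2 ℤ.* (+ q ℤ.* + q)
      ≡⟨ ℤₚ.*-assoc (+ 2) (+ q) (+ q) ⟨
    + 2 ℤ.* + q ℤ.* + q ∎)
    where
    B : ℤ → ℤ
    B a = + 3 ℤ.* a ℤ.* (+ 3 ℤ.* a)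
    2q≢0 : ℤ.NonZero (+ 2 ℤ.* + q)
    2q≢0 = ℤₚ.i*j≢0 (+ 2) (+ q) ⦃ _ ⦄ ⦃ ≡.subst ℕ.NonZero (≡.sym q≡3^1+k) (ℕₚ.m^n≢0 3 (suc k)) ⦄

  S₀≡-2σ : S₀ ≡ ℤ.- (+ 2 ℤ.* σ)
  S₀≡-2σ = ≡.trans (∑-cong λ x → χ-cong (sym (+-identityʳ (L x)))) (S-0 (trace-0 (suc k)))

  σ-unique : ∀ {γ} → ¬ Square γ → ∀ {p} → p ℤ.* p ≡ + q → + 4 ∣ᶻ p ℤ.- 1ℤ → σ ≡ p
  σ-unique γ-nonsquare {p} p²≡q =
    square-root-unique σ p σ² p²≡q (4∣1-s S₀ σ (+ q ℤ.- 1ℤ) S₀≡-2σ 8∣q-1 (S₀-mod-8 γ-nonsquare))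

-- Counting a decidable set of pairs together with one extra point

module PairSubset {a ℓ} (S : Setoid a ℓ) {n} (card : HasCardinality S n) {p}
  (P : Setoid.Carrier S × Setoid.Carrier S → Set p)
  (P-resp : ∀ {x x′ y y′} → Setoid._≈_ S x x′ → Setoid._≈_ S y y′ → P (x , y) → P (x′ , y′))
  (P? : ∀ z → Dec (P z)) where
  open Setoid S
  open Finite S card
  open Sum ℤₚ.+-0-commutativeMonoid using (∑)
  open ≡.≡-Reasoning

  pair : Fin (n ℕ.* n) → Carrier × Carrier
  pair i = from (proj₁ (remQuot n i)) , from (proj₂ (remQuot {n} n i))

  code : Carrier × Carrier → Fin (n ℕ.* n)
  code (x , y) = combine (to x) (to y)

  pair-code : ∀ x y → proj₁ (pair (code (x , y))) ≈ x × proj₂ (pair (code (x , y))) ≈ y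
  pair-code x y = trans (from-cong (cong proj₁ (Fin.remQuot-combine {n} (to x) (to y)))) (strictlyInverseʳ x) ,
                  trans (from-cong (cong proj₂ (Fin.remQuot-combine {n} (to x) (to y)))) (strictlyInverseʳ y)

  code-pair : ∀ i → code (pair i) ≡ i
  code-pair i =
    ≡.trans (cong₂ combine (strictlyInverseˡ (proj₁ (remQuot {n} n i))) (strictlyInverseˡ (proj₂ (remQuot {n} n i))))
      (Fin.combine-remQuot {n} n i)

  setoid⁺ : Setoid _ _
  setoid⁺ = Maybe.setoid (On.setoid {B = Σ-syntax (Carrier × Carrier) P} (×-setoid S S) proj₁)

  private
    module M = Setoid setoid⁺
    module E = SubsetEnumeration (proj₁ (proj₂ (enumerate (P? ∘ pair))))

  size : ℕ
  size = suc (proj₁ (enumerate (P? ∘ pair)))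

  toFin : M.Carrier → Fin size
  toFin nothing              = zero
  toFin (just ((x , y) , p)) =
    -- The enumeration knows only the representatives `pair (code (x , y))`, so the proof is
    -- transported to them. The index `zero` is kept for `nothing`.
    suc (E.index (code (x , y)) (P-resp (sym (proj₁ (pair-code x y))) (sym (proj₂ (pair-code x y))) p))

  fromFin : Fin size → M.Carrier
  fromFin zero    = nothing
  fromFin (suc j) = just (pair (E.element j) , E.element-∈ j)

  toFin-cong : ∀ {u v} → u M.≈ v → toFin u ≡ toFin v
  toFin-cong Maybe.nothing              = ≡.refl
  toFin-cong (Maybe.just (x≈x′ , y≈y′)) = cong suc (E.element-injective
    (≡.trans (E.element-index _ _) (≡.trans (cong₂ combine (to-cong x≈x′) (to-cong y≈y′))
      (≡.sym (E.element-index _ _)))))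

  toFin-fromFin : ∀ j → toFin (fromFin j) ≡ j
  toFin-fromFin zero    = ≡.refl
  toFin-fromFin (suc j) = cong suc (E.element-injective (≡.trans (E.element-index _ _) (code-pair (E.element j))))

  fromFin-toFin : ∀ u → fromFin (toFin u) M.≈ u
  fromFin-toFin nothing              = Maybe.nothing
  fromFin-toFin (just ((x , y) , p)) =
    Maybe.just (≡.subst (λ i → proj₁ (pair i) ≈ x × proj₂ (pair i) ≈ y) (≡.sym (E.element-index _ _))
      (pair-code x y))

  hasCardinality : HasCardinality setoid⁺ size
  hasCardinality = record
    { to        = toFin
    ; from      = fromFin
    ; to-cong   = toFin-cong
    ; from-cong = λ { ≡.refl → M.refl }
    ; inverse   = (λ {j} u≈ → ≡.trans (toFin-cong u≈) (toFin-fromFin j)) , (λ { {u} ≡.refl → fromFin-toFin u })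
    }

  size≡∑ : + size ≡ 1ℤ ℤ.+ ∑ (λ x → ∑ λ y → ⟦ P? (x , y) ⟧)
  size≡∑ = cong (ℤ._+_ 1ℤ) (begin
    + proj₁ (enumerate (P? ∘ pair))
      ≡⟨ proj₂ (proj₂ (enumerate (P? ∘ pair))) ⟩
    ℤSum.sum (λ i → ⟦ P? (pair i) ⟧)
      ≡⟨ FinSum.sum-combine ℤₚ.+-0-commutativeMonoid n {n} (λ i → ⟦ P? (pair i) ⟧) ⟩
    ℤSum.sum {n} (λ i → ℤSum.sum {n} λ j → ⟦ P? (pair (combine i j)) ⟧)
      ≡⟨ sum-cong-≗ {n} (λ i → sum-cong-≗ {n} λ j →
           cong (λ z → ⟦ P? (from (proj₁ z) , from (proj₂ z)) ⟧) (Fin.remQuot-combine i j)) ⟩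
    ∑ (λ x → ∑ λ y → ⟦ P? (x , y) ⟧)                                         ∎)
    where open CommutativeMonoidSum ℤₚ.+-0-commutativeMonoid using (sum-cong-≗)

-- The curve as a twisted Artin-Schreier equation

module PointCount {c ℓ₁ ℓ₂} (K : HeytingField c ℓ₁ ℓ₂) {q} (card : HasCardinality (HeytingField.setoid K) q)
  (3≈0 : HasCharacteristic3 (HeytingCommutativeRing.commutativeRing (HeytingField.heytingCommutativeRing K)))
  (8∣q-1 : + 8 ∣ᶻ + q ℤ.- 1ℤ) where
  open HeytingField K using (_#_; heytingCommutativeRing)
  open HeytingCommutativeRing heytingCommutativeRing using (commutativeRing)
  open CommutativeRing commutativeRing hiding (zero)
  open OverField K using (_^_; inverse; IsUnitSquare; EllipticCurve; points)
  open FiniteField K card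
  open FiniteIntegerSum setoid card
  open Characteristic3 commutativeRing 3≈0
  open SquareCounting K card 3≈0
  open ArtinSchreierSum K card 3≈0
  open QuadraticCharacterModulo8 K card 3≈0 8∣q-1
  open import Algebra.Properties.Semiring.Exp semiring using (^-congˡ)
  private module R = SetoidReasoning setoid
  open ≡.≡-Reasoning

  module _ (E : EllipticCurve) {γ : Carrier} (γ#0 : γ # 0#)
    (-a₄≈γ² : - EllipticCurve.a₄ E ≈ γ ^ 2) (γ-nonsquare : ¬ IsUnitSquare γ) where
    open EllipticCurve E

    -- Any root `y` of `γ` is invertible, with inverse `y * inverse γ#0`, so excluding unit squares
    -- excludes all squares.
    ¬Square-γ : ¬ Square γ
    ¬Square-γ (y , y²≈γ) = γ-nonsquare (y , inverse⇒#0 (R.begin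
      y * (y * inverse γ#0)      R.≈⟨ *-assoc _ _ _ ⟨
      y * y * inverse γ#0        R.≈⟨ *-congʳ y²≈γ ⟩
      γ * inverse γ#0            R.≈⟨ #0⇒inverse γ#0 ⟩
      1#                         R.∎) , trans (sym y²≈γ) (*-congˡ (sym (*-identityʳ y))))

    parameter : Carrier
    parameter = b * inverse γ#0 ^ 3

    cubic : Carrier → Carrier
    cubic x = x ^ 3 + a₄ * x + b

    cubic-cong : ∀ {x y} → x ≈ y → cubic x ≈ cubic y
    cubic-cong x≈y = +-congʳ (+-cong (^-congˡ 3 x≈y) (*-congˡ x≈y))

    cubic-scaled : ∀ x → cubic (γ * x) ≈ γ * γ * (γ * (L x + parameter))
    cubic-scaled x = R.begin
      (γ * x) ^ 3 + a₄ * (γ * x) + b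
        -- The factor `1# ^ 3` is inserted beside `b` to become `(γ * inverse γ#0) ^ 3`, from which
        -- `γ ^ 3` is extracted; the double negation exposes `- a₄`.
        R.≈⟨ solve 4 (λ g x a b → (g :* x) :^ 3 :+ a :* (g :* x) :+ b
                        := (g :* x) :^ 3 :- :- a :* (g :* x) :+ b :* (con 1₃ :^ 3)) refl γ x a₄ b ⟩
      (γ * x) ^ 3 - (- a₄) * (γ * x) + b * 1# ^ 3
        R.≈⟨ +-cong (+-congˡ (-‿cong (*-congʳ -a₄≈γ²))) (*-congˡ (^-congˡ 3 (sym (#0⇒inverse γ#0)))) ⟩
      (γ * x) ^ 3 - γ ^ 2 * (γ * x) + b * (γ * inverse γ#0) ^ 3
        R.≈⟨ solve 4 (λ g x b i → (g :* x) :^ 3 :- g :^ 2 :* (g :* x) :+ b :* (g :* i) :^ 3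
                        := g :* g :* (g :* (x :* x :* x :- x :+ b :* i :^ 3))) refl γ x b (inverse γ#0) ⟩
      γ * γ * (γ * (L x + parameter)) R.∎

    -- Of the factor `γ ^ 3`, the square `γ * γ` leaves the number of roots unchanged, while the
    -- remaining nonsquare `γ` reverses the sign of `χ`.
    affine-count : ∑ (λ x → ∑ λ y → δ (y ^ 2) (cubic x)) ≡ + q ℤ.- S parameter
    affine-count = begin
      ∑ (λ x → ∑ λ y → δ (y ^ 2) (cubic x))
        ≡⟨ ∑-cong (λ x → ∑-cong λ y → δ-cong (*-congˡ {y} (*-identityʳ y)) (refl {cubic x})) ⟩
      ∑ (λ x → N (cubic x))
        ≡⟨ ∑-reindex {N ∘ cubic} (N-cong ∘ cubic-cong) (γ *_) (inverse γ#0 *_) *-congˡ *-congˡ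
             (x*y≈1⇒x*yz≈z (#0⇒inverse γ#0))
             (x*y≈1⇒x*yz≈z (trans (*-comm _ _) (#0⇒inverse γ#0))) ⟩
      ∑ (λ x → N (cubic (γ * x)))
        ≡⟨ ∑-cong (λ x → ≡.trans (N-cong (cubic-scaled x)) (≡.trans
             (N-scale (#0⇒≉0 γ#0) (γ * (L x + parameter))) (N-γ ¬Square-γ (L x + parameter)))) ⟩
      ∑ (λ x → 1ℤ ℤ.- χ (L x + parameter))              ≡⟨ ∑-- (λ _ → 1ℤ) (λ x → χ (L x + parameter)) ⟩
      ∑ (λ _ → 1ℤ) ℤ.- S parameter
        ≡⟨ cong (ℤ._- S parameter) (≡.trans (∑-const 1ℤ) (ℤₚ.*-identityʳ (+ q))) ⟩
      + q ℤ.- S parameter                               ∎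

    private
      module Points = PairSubset setoid card (λ (x , y) → y ^ 2 ≈ x ^ 3 + a₄ * x + b)
        (λ x≈x′ y≈y′ eq → trans (^-congˡ 2 (sym y≈y′)) (trans eq (cubic-cong x≈x′))) (λ (x , y) → y ^ 2 ≟ cubic x)

    point-count : ∃[ n ] HasCardinality (points E) n × + n ≡ + q ℤ.+ 1ℤ ℤ.- S parameter
    point-count = Points.size , Points.hasCardinality , (begin
      + Points.size                                     ≡⟨ Points.size≡∑ ⟩
      1ℤ ℤ.+ ∑ (λ x → ∑ λ y → δ (y ^ 2) (cubic x))      ≡⟨ cong (ℤ._+_ 1ℤ) affine-count ⟩
      1ℤ ℤ.+ (+ q ℤ.- S parameter)
        ≡⟨ solveℤ 2 (λ q s → κ 1ℤ ⊕ (q ⊖ s) ⊜ q ⊕ κ 1ℤ ⊖ s) ≡.refl (+ q) (S parameter) ⟩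
      + q ℤ.+ 1ℤ ℤ.- S parameter                        ∎)

-- Powers of 3 and of -1 modulo 4 and 8

private
  -1^m-square : ∀ m → -1ℤ ℤ.^ m ℤ.* -1ℤ ℤ.^ m ≡ 1ℤ
  -1^m-square zero    = ≡.refl
  -1^m-square (suc m) =
    ≡.trans (solveℤ 1 (λ e → (κ -1ℤ ⊗ e) ⊗ (κ -1ℤ ⊗ e) ⊜ e ⊗ e) ≡.refl (-1ℤ ℤ.^ m)) (-1^m-square m)

  signed-square : ∀ m r → (-1ℤ ℤ.^ m ℤ.* + r) ℤ.* (-1ℤ ℤ.^ m ℤ.* + r) ≡ + (r ℕ.* r)
  signed-square m r = begin
    (e ℤ.* + r) ℤ.* (e ℤ.* + r)
      ≡⟨ solveℤ 2 (λ e r → (e ⊗ r) ⊗ (e ⊗ r) ⊜ (e ⊗ e) ⊗ (r ⊗ r)) ≡.refl e (+ r) ⟩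
    (e ℤ.* e) ℤ.* (+ r ℤ.* + r)      ≡⟨ cong₂ ℤ._*_ (-1^m-square m) (≡.sym (ℤₚ.pos-* r r)) ⟩
    1ℤ ℤ.* + (r ℕ.* r)               ≡⟨ ℤₚ.*-identityˡ _ ⟩
    + (r ℕ.* r)                      ∎
    where
    open ≡.≡-Reasoning
    e = -1ℤ ℤ.^ m

  -- The number is `(- 3) ^ m - 1`, and `- 3` is 1 modulo 4. This is the origin of the sign
  -- `(- 1) ^ (d / 2)`.
  4∣[-3]^m-1 : ∀ m → + 4 ∣ᶻ -1ℤ ℤ.^ m ℤ.* + (3 ℕ.^ m) ℤ.- 1ℤ
  4∣[-3]^m-1 zero    = divides 0ℤ ≡.refl
  4∣[-3]^m-1 (suc m) = ≡.subst (+ 4 ∣ᶻ_) (begin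
    ℤ.- (+ 3) ℤ.* (e ℤ.* t ℤ.- 1ℤ) ℤ.- + 4
      ≡⟨ solveℤ 2 (λ e t → κ (ℤ.- (+ 3)) ⊗ (e ⊗ t ⊖ κ 1ℤ) ⊖ κ (+ 4)
           ⊜ κ -1ℤ ⊗ e ⊗ (κ (+ 3) ⊗ t) ⊖ κ 1ℤ) ≡.refl e t ⟩
    -1ℤ ℤ.* e ℤ.* (+ 3 ℤ.* t) ℤ.- 1ℤ                ≡⟨ cong (λ s → -1ℤ ℤ.* e ℤ.* s ℤ.- 1ℤ) (ℤₚ.pos-* 3 (3 ℕ.^ m)) ⟨
    -1ℤ ℤ.* e ℤ.* + (3 ℕ.^ suc m) ℤ.- 1ℤ            ∎)
    (∣m∣n⇒∣m-n (∣n⇒∣m*n (ℤ.- (+ 3)) (4∣[-3]^m-1 m)) (divides 1ℤ ≡.refl))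
    where
    open ≡.≡-Reasoning
    e = -1ℤ ℤ.^ m
    t = + (3 ℕ.^ m)

  -- `9` is 1 modulo 8; the evenness of `d` enters here.
  8∣9^m-1 : ∀ m → + 8 ∣ᶻ + (3 ℕ.^ (m ℕ.* 2)) ℤ.- 1ℤ
  8∣9^m-1 zero    = divides 0ℤ ≡.refl
  8∣9^m-1 (suc m) = ≡.subst (+ 8 ∣ᶻ_) (begin
    + 9 ℤ.* (t ℤ.- 1ℤ) ℤ.+ + 8
      ≡⟨ solveℤ 1 (λ t → κ (+ 9) ⊗ (t ⊖ κ 1ℤ) ⊕ κ (+ 8)
           ⊜ κ (+ 3) ⊗ (κ (+ 3) ⊗ t) ⊖ κ 1ℤ) ≡.refl t ⟩
    + 3 ℤ.* (+ 3 ℤ.* t) ℤ.- 1ℤ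
      ≡⟨ cong (ℤ._- 1ℤ) (≡.trans (ℤₚ.pos-* 3 (3 ℕ.* 3 ℕ.^ (m ℕ.* 2)))
           (cong (+ 3 ℤ.*_) (ℤₚ.pos-* 3 (3 ℕ.^ (m ℕ.* 2))))) ⟨
    + (3 ℕ.^ (suc m ℕ.* 2)) ℤ.- 1ℤ                  ∎)
    (∣m∣n⇒∣m+n (∣n⇒∣m*n (+ 9) (8∣9^m-1 m)) (divides 1ℤ ≡.refl))
    where
    open ≡.≡-Reasoning
    t = + (3 ℕ.^ (m ℕ.* 2))

  square-injective-ℕ : ∀ m n → m ℕ.* m ≡ n ℕ.* n → m ≡ n
  square-injective-ℕ m n eq with ℕₚ.<-cmp m n
  ... | tri< m<n _ _ = contradiction eq (ℕₚ.<⇒≢ (ℕₚ.*-mono-< m<n m<n))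
  ... | tri≈ _ m≡n _ = m≡n
  ... | tri> _ _ n<m = contradiction (≡.sym eq) (ℕₚ.<⇒≢ (ℕₚ.*-mono-< n<m n<m))

  3^-sqrt : ∀ m r → r ℕ.* r ≡ 3 ℕ.^ (m ℕ.* 2) → r ≡ 3 ℕ.^ m
  3^-sqrt m r eq = square-injective-ℕ r (3 ℕ.^ m) (begin
    r ℕ.* r                           ≡⟨ eq ⟩
    3 ℕ.^ (m ℕ.* 2)                   ≡⟨ ℕₚ.^-*-assoc 3 m 2 ⟨
    3 ℕ.^ m ℕ.* (3 ℕ.^ m ℕ.* 1)       ≡⟨ cong (3 ℕ.^ m ℕ.*_) (ℕₚ.*-identityʳ _) ⟩
    3 ℕ.^ m ℕ.* 3 ℕ.^ m               ∎)
    where open ≡.≡-Reasoning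

-- The point count in terms of a signed square root of `q`

module _ {c ℓ₁ ℓ₂} (K : HeytingField c ℓ₁ ℓ₂) {q} (card : HasCardinality (HeytingField.setoid K) q)
  (k : ℕ) (q≡3^1+k : q ≡ 3 ℕ.^ suc k) (8∣q-1 : + 8 ∣ᶻ + q ℤ.- 1ℤ) where
  open HeytingField K
  open OverField K
  open HeytingCommutativeRing heytingCommutativeRing using (commutativeRing)
  open FiniteField K card using (q·1≈0; m^n·1≈0⇒m·1≈0)
  open Semiring (CommutativeRing.semiring commutativeRing) using (rawSemiring)
  open import Algebra.Definitions.RawSemiring rawSemiring using () renaming (_×_ to _·_)

  -- The characteristic comes from the cardinality alone: `q · 1# ≈ 0#`, `q` is a power of 3, and a
  -- field has no zero divisors.
  characteristic3 : HasCharacteristic3 commutativeRing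
  characteristic3 = trans (trans (+-assoc 1# 1# 1#) (+-congˡ (+-congˡ (sym (+-identityʳ 1#)))))
    (m^n·1≈0⇒m·1≈0 3 (suc k) (≡.subst (λ n → n · 1# ≈ 0#) q≡3^1+k q·1≈0))

  private
    module C = TraceClasses K card characteristic3 8∣q-1 k q≡3^1+k
    module P = PointCount K card characteristic3 8∣q-1

  -- The conditions single out `p` as the square root of `q` that is 1 modulo 4, hence as `σ`.
  -- Keeping `p` abstract separates the count from the formula for the sign.
  twisted-point-count : ∀ p → p ℤ.* p ≡ + q → + 4 ∣ᶻ p ℤ.- 1ℤ →
    (E : EllipticCurve) (γ : Carrier) (γ#0 : γ # 0#) → - EllipticCurve.a₄ E ≈ γ ^ 2 → ¬ IsUnitSquare γ →
    let t = Tr (suc k) (EllipticCurve.b E * inverse γ#0 ^ 3) in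
    Σ[ #E ∈ ℕ ] HasCardinality (points E) #E
      × (t ≈ 0# → + #E ≡ + q ℤ.+ + 1 ℤ.+ + 2 ℤ.* p)
      × (t ≈ 1# ⊎ t ≈ - 1# → + #E ≡ + q ℤ.+ + 1 ℤ.- p)
  twisted-point-count p p²≡q 4∣p-1 E γ γ#0 -a₄≈γ² γ-nonsquare =
    let #E , hasCardinality , #E≡ = P.point-count E γ#0 -a₄≈γ² γ-nonsquare
        σ≡p = C.σ-unique (P.¬Square-γ E γ#0 -a₄≈γ² γ-nonsquare) {p} p²≡q 4∣p-1 in
    #E , hasCardinality ,
    (λ t≈0 → ≡.trans #E≡ (≡.trans (cong (ℤ._-_ (+ q ℤ.+ 1ℤ)) (≡.trans (C.S-0 t≈0) (cong (λ s → ℤ.- (+ 2 ℤ.* s)) σ≡p)))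
      (solveℤ 2 (λ q p → q ⊖ (⊝ (κ (+ 2) ⊗ p)) ⊜ q ⊕ κ (+ 2) ⊗ p) ≡.refl (+ q ℤ.+ 1ℤ) p))) ,
    (λ t≈±1 → ≡.trans #E≡ (cong (ℤ._-_ (+ q ℤ.+ 1ℤ)) (≡.trans (C.S-±1 t≈±1) σ≡p)))

proposition3p4 :
    ∀ {c ℓ₁ ℓ₂} (d : ℕ) → 2 ∣ d →
    (K : HeytingField c ℓ₁ ℓ₂) →
    let open HeytingField K
        open OverField K
        q = 3 ℕ.^ d
    in
    HasCardinality setoid q →
    (√q : ℕ) → √q ℕ.* √q ≡ q →
    (E : EllipticCurve) →
    let open EllipticCurve E
    in
    (γ : Carrier) (γ#0 : γ # 0#) →
    - a₄ ≈ γ ^ 2 →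
    ¬ IsUnitSquare γ →
    let t = Tr d (b * inverse γ#0 ^ 3)
        ε = -1ℤ ℤ.^ (d ℕ./ 2)
    in
    Σ[ #E ∈ ℕ ]
      HasCardinality (points E) #E
      × (t ≈ 0# → + #E ≡ + q ℤ.+ + 1 ℤ.+ ε ℤ.* (+ 2 ℤ.* + √q))
      × (t ≈ 1# ⊎ t ≈ - 1# → + #E ≡ + q ℤ.+ + 1 ℤ.- ε ℤ.* + √q)
-- For `d = 0` the carrier would have a single element, which contradicts `γ # 0#`.
proposition3p4 .(zero ℕ.* 2) (ℕ.divides zero ≡.refl) K card _ _ _ γ γ#0 _ _ =
  contradiction (Finite.to-injective (HeytingField.setoid K) card (unique _ _)) (FiniteField.#0⇒≉0 K card γ#0)
  where
  unique : (i j : Fin 1) → i ≡ j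
  unique zero zero = ≡.refl
proposition3p4 .(suc m ℕ.* 2) (ℕ.divides (suc m) ≡.refl) K card √q √q²≡q E γ γ#0 -a₄≈γ² γ-nonsquare
  rewrite ℕ.m*n/n≡m (suc m) 2 ⦃ _ ⦄ =
  let #E , hasCardinality , count₀ , count₁ = twisted-point-count K card (suc (m ℕ.* 2)) ≡.refl (8∣9^m-1 (suc m))
        p p²≡q 4∣p-1 E γ γ#0 -a₄≈γ² γ-nonsquare in
  #E , hasCardinality , (λ t≈0 → ≡.trans (count₀ t≈0) (cong (ℤ._+_ (+ q ℤ.+ + 1)) 2p≡)) , count₁
  where
  q = 3 ℕ.^ (suc m ℕ.* 2)
  ε = -1ℤ ℤ.^ suc m
  p = ε ℤ.* + √q
  p²≡q : p ℤ.* p ≡ + q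
  p²≡q = ≡.trans (signed-square (suc m) √q) (cong +_ √q²≡q)
  4∣p-1 : + 4 ∣ᶻ p ℤ.- 1ℤ
  4∣p-1 = ≡.subst (λ r → + 4 ∣ᶻ ε ℤ.* + r ℤ.- 1ℤ) (≡.sym (3^-sqrt (suc m) √q √q²≡q)) (4∣[-3]^m-1 (suc m))
  2p≡ : + 2 ℤ.* p ≡ ε ℤ.* (+ 2 ℤ.* + √q)
  2p≡ = solveℤ 2 (λ e r → κ (+ 2) ⊗ (e ⊗ r) ⊜ e ⊗ (κ (+ 2) ⊗ r)) ≡.refl ε (+ √q)
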